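{- Let $\mathbb{F}$ be a finite field of characteristic $2$ and let $P\in\mathbb{F}[x_1,\dots,x_m]$ be a multilinear polynomial. The following are equivalent: (i) $P$ is representable; (ii) for every $\ell\in\mathbb{F}^m$, $P$ is factorizable modulo $\mathcal{I}(\ell^2)$; (iii) there exists $\ell\in\mathbb{F}^m$ such that $P$ is factorizable modulo $\mathcal{I}(\ell^2)$. Here $\ell^2=(\ell_1^2,\dots,\ell_m^2)$ for $\ell=(\ell_1,\dots,\ell_m)$.
   Context: A polynomial is multilinear if each of its monomials has degree at most $1$ in each variable. A polynomial $P\in\mathbb{F}[x_1,\dots,x_m]$ is representable if there is a symmetric matrix $M$ with all entries in $\mathbb{F}\cup\{x_1,\dots,x_m\}$ with $\det(M)=P$. For $\lambda\in\mathbb{F}^m$, let $\mathcal{I}(\lambda)=\langle x_1^2+\lambda_1,\dots,x_m^2+\lambda_m\rangle$, $\mathcal{R}(\lambda)=\mathbb{F}[x_1,\dots,x_m]/\mathcal{I}(\lambda)$, and $\pi_\lambda$ the canonical projection. An element of $\mathcal{R}(\lambda)$ is linear if it is the projection of a polynomial of total degree at most $1$. $P$ is factorizable modulo $\mathcal{I}(\lambda)$ if $\pi_\lambda(P)=t_1\cdots t_k$ for some linear elements $t_1,\dots,t_k$ of $\mathcal{R}(\lambda)$. -}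

module Defs where

open import Level using (Level; _⊔_; Lift)
open import Algebra.Bundles using (CommutativeRing)
open import Data.Nat as ℕ using (ℕ; zero; suc; _∸_)
open import Data.Fin using (Fin; zero; suc; punchIn)
open import Data.Vec using (Vec; []; _∷_; lookup)
open import Data.List using (List; []; _∷_; map; concatMap; foldr; upTo)
open import Data.Product using (Σ; ∃; _×_; _,_)
open import Data.Sum using (_⊎_; inj₁; inj₂)
open import Data.Empty using (⊥)
open import Relation.Binary.PropositionalEquality using (_≡_)
open import Relation.Nullary using (¬_)

module _ {c ℓ : Level} (R : CommutativeRing c ℓ) where
  open CommutativeRing R using (Carrier; _≈_; _+_; _*_; -_; 0#; 1#)

  record IsFiniteField : Set (c ⊔ ℓ) where
    field
      nontrivial : ¬ (1# ≈ 0#)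
      inverse    : ∀ x → ¬ (x ≈ 0#) → ∃ λ y → x * y ≈ 1#
      size       : ℕ
      to         : Carrier → Fin size
      from       : Fin size → Carrier
      to-cong    : ∀ {x y} → x ≈ y → to x ≡ to y
      from-to    : ∀ x → from (to x) ≈ x
      to-from    : ∀ i → to (from i) ≡ i

  Char2 : Set ℓ
  Char2 = 1# + 1# ≈ 0#

  data Expr (m : ℕ) : Set c where
    con  : Carrier → Expr m
    var  : Fin m → Expr m
    _⊕_  : Expr m → Expr m → Expr m
    _⊗_  : Expr m → Expr m → Expr m
    neg  : Expr m → Expr m

  Mono : ℕ → Set
  Mono m = Vec ℕ m

  zeroMono : ∀ {m} → Mono m
  zeroMono {zero}  = []
  zeroMono {suc m} = 0 ∷ zeroMono

  unitMono : ∀ {m} → Fin m → Mono m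
  unitMono {suc m} zero    = 1 ∷ zeroMono
  unitMono {suc m} (suc i) = 0 ∷ unitMono i

  below : ∀ {m} → Mono m → List (Mono m)
  below []      = [] ∷ []
  below (a ∷ α) = concatMap (λ k → map (k ∷_) (below α)) (upTo (suc a))

  monus : ∀ {m} → Mono m → Mono m → Mono m
  monus []      []      = []
  monus (a ∷ α) (b ∷ β) = (a ∸ b) ∷ monus α β

  sumR : List Carrier → Carrier
  sumR = foldr _+_ 0#

  isZeroMono : ∀ {m} → Mono m → Carrier → Carrier
  isZeroMono [] r = r
  isZeroMono (zero  ∷ α) r = isZeroMono α r
  isZeroMono (suc _ ∷ α) r = 0#

  isUnitMono : ∀ {m} → Fin m → Mono m → Carrier
  isUnitMono {suc m} zero    (1 ∷ α) = isZeroMono α 1#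
  isUnitMono {suc m} zero    (_ ∷ α) = 0#
  isUnitMono {suc m} (suc i) (0 ∷ α) = isUnitMono i α
  isUnitMono {suc m} (suc i) (_ ∷ α) = 0#

  coeff : ∀ {m} → Expr m → Mono m → Carrier
  coeff (con a)   α = isZeroMono α a
  coeff (var i)   α = isUnitMono i α
  coeff (p ⊕ q)   α = coeff p α + coeff q α
  coeff (p ⊗ q)   α = sumR (map (λ β → coeff p β * coeff q (monus α β)) (below α))
  coeff (neg p)   α = - coeff p α

  _≋_ : ∀ {m} → Expr m → Expr m → Set ℓ
  p ≋ q = ∀ α → coeff p α ≈ coeff q α

  Multilinear : ∀ {m} → Expr m → Set ℓ
  Multilinear {m} P = ∀ (α : Mono m) (i : Fin m) → 2 ℕ.≤ lookup α i → coeff P α ≈ 0#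

  ΣE : ∀ {m n} → (Fin n → Expr m) → Expr m
  ΣE {n = zero}  f = con 0#
  ΣE {n = suc n} f = f zero ⊕ ΣE (λ i → f (suc i))

  ΠE : ∀ {m n} → (Fin n → Expr m) → Expr m
  ΠE {n = zero}  f = con 1#
  ΠE {n = suc n} f = f zero ⊗ ΠE (λ i → f (suc i))

  sign : ∀ {m} → ℕ → Expr m → Expr m
  sign zero    e = e
  sign (suc k) e = neg (sign k e)

  det : ∀ {m n} → (Fin n → Fin n → Expr m) → Expr m
  det {n = zero}  M = con 1#
  det {n = suc n} M =
    ΣE (λ j → sign (Data.Fin.toℕ j) (M zero j ⊗ det (λ r s → M (suc r) (punchIn j s))))

  Entry : ℕ → Set c
  Entry m = Carrier ⊎ Fin m

  entryExpr : ∀ {m} → Entry m → Expr m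
  entryExpr (inj₁ a) = con a
  entryExpr (inj₂ i) = var i

  _≈ᴱ_ : ∀ {m} → Entry m → Entry m → Set ℓ
  inj₁ a ≈ᴱ inj₁ b = a ≈ b
  inj₂ i ≈ᴱ inj₂ j = Lift ℓ (i ≡ j)
  _      ≈ᴱ _      = Lift ℓ ⊥

  Symmetric : ∀ {m n} → (Fin n → Fin n → Entry m) → Set ℓ
  Symmetric M = ∀ i j → M i j ≈ᴱ M j i

  Representable : ∀ {m} → Expr m → Set (c ⊔ ℓ)
  Representable {m} P =
    Σ ℕ λ n → Σ (Fin n → Fin n → Entry m) λ M →
      Symmetric M × (det (λ i j → entryExpr (M i j)) ≋ P)

  linearExpr : ∀ {m} → Carrier → (Fin m → Carrier) → Expr m
  linearExpr a₀ a = con a₀ ⊕ ΣE (λ i → con (a i) ⊗ var i)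

  InIdeal : ∀ {m} → (Fin m → Carrier) → Expr m → Set (c ⊔ ℓ)
  InIdeal {m} λ' Q =
    Σ (Fin m → Expr m) λ h → Q ≋ ΣE (λ i → h i ⊗ ((var i ⊗ var i) ⊕ con (λ' i)))

  -- P factorizable modulo I(λ): π(P) = t_1 ⋯ t_k with t_j linear, i.e.
  -- P − L_1 ⋯ L_k ∈ I(λ) for some polynomials L_j of total degree ≤ 1
  FactorizableMod : ∀ {m} → (Fin m → Carrier) → Expr m → Set (c ⊔ ℓ)
  FactorizableMod {m} λ' P =
    Σ ℕ λ k → Σ (Fin k → Carrier) λ a₀ → Σ (Fin k → Fin m → Carrier) λ a →
      InIdeal λ' (P ⊕ neg (ΠE (λ j → linearExpr (a₀ j) (a j))))

  squares : ∀ {m} → (Fin m → Carrier) → Fin m → Carrier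
  squares l i = l i * l i

{-# OPTIONS --safe #-}
module Submission where

-- A symmetric determinant in characteristic 2 is a sum over involutions, since the other terms of
-- the Leibniz formula cancel in pairs; it depends only on the diagonal and on the squares of the
-- off-diagonal entries.  In R(ℓ²) every square is a constant, so this determinant is the coefficient
-- of θ₁⋯θₙ in the product of all 1 + Mᵢᵢθᵢ and 1 + Mᵢⱼ²θᵢθⱼ (i < j), the θᵢ being new variables of
-- square zero.  These factors are products of linear elements, and the coefficient of θᵢ in a product of
-- linear elements is again a product of linear elements, which gives the factorization.
-- Conversely, L₁⋯Lₖ is the determinant of diag(L₁,…,Lₖ), and adding to it off-diagonal entries that
-- square to zero changes nothing modulo the ideal.  With square roots vⱼᵢ of the coefficients, this
-- turns the matrix into A + ∑ᵢ xᵢ vᵢ vᵢᵀ with A constant.  Bordering then produces a matrix in which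
-- each variable occurs once.  Its determinant is multilinear and hence equals P, as a multilinear
-- polynomial in the ideal vanishes.

open import Defs
open import Level using (Level; _⊔_; lift)
open import Algebra.Bundles using (CommutativeRing; AbelianGroup)
open import Algebra.Core using (Op₁; Op₂)
open import Algebra.Solver.Ring.AlmostCommutativeRing using (_-Raw-AlmostCommutative⟶_; fromCommutativeRing)
open import Data.Bool.Base using (Bool; true; false)
import Data.Bool.Properties as Bool
open import Data.Fin using (Fin; zero; suc; punchIn; toℕ)
import Data.Fin.Properties as Fin
open import Data.List using (List; []; _∷_; _++_; map; concatMap; applyUpTo)
open import Data.List.Properties using (map-∘; map-applyUpTo; map-++)
open import Data.Maybe.Base using (Maybe; just; nothing)
open import Data.Nat as ℕ using (ℕ; zero; suc; _∸_; z≤n; s≤s)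
import Data.Nat.Properties as ℕ
open import Data.Product using (Σ; ∃; _×_; _,_; proj₁; proj₂)
open import Data.Sum using (inj₁; inj₂)
open import Data.Unit.Polymorphic.Base using (⊤; tt)
open import Data.Vec using ([]; _∷_; lookup)
import Data.Vec.Functional as Functional
open import Function.Base using (_∘_; id)
open import Function.Bundles using (_⇔_; mk⇔)
open import Relation.Binary.Core using (Rel)
open import Relation.Binary.PropositionalEquality as ≡ using (_≡_; _≢_)
open import Relation.Binary.Structures using (IsEquivalence)
open import Relation.Nullary.Decidable using (Dec; yes; no)
open import Relation.Nullary.Negation using (contradiction)
import Algebra.Definitions
import Algebra.Properties.CommutativeMonoid.Sum
import Algebra.Properties.Group
import Algebra.Properties.Semiring.Sum
import Algebra.Solver.Ring
import Algebra.Solver.Ring.NaturalCoefficients.Default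
import Relation.Binary.Reasoning.Setoid

-- Determinants of symmetric matrices in characteristic 2

-- That the constants of the ideal are squares is what makes R(ℓ²) tractable: xᵢ ↦ ℓᵢ defines a
-- homomorphism ρ to F, and as squaring is additive, x² = ρ(x)² for every x. Hence x has square zero
-- if ρ(x) = 0; otherwise it is a unit whose inverse x/ρ(x)² is linear whenever x is. This dichotomy
-- is the reason why the θ-coefficient of a product of linear elements factors again: factors a + eθ
-- with a a unit become a(1 + μθ) with μ linear, and those with a nilpotent and e nonzero become e(θ
-- + α) with α² = 0. Adjoining θ with θ² = 0 is the same construction as adjoining xᵢ, with value 0
-- in place of ℓᵢ, so one notion of linearity covers both kinds of variables and passes through
-- towers of them. Finiteness of F enters twice: it decides whether ρ(x) is zero, and it provides
-- the square roots that turn a linear form on the diagonal into a sum of rank-one matrices.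

module _ {c ℓ : Level} where

  module _ {A : Set c} {_≈_ : Rel A ℓ} (isEquivalence : IsEquivalence _≈_)
           (_+_ _*_ : Op₂ A) (-_ : Op₁ A) (0# 1# : A) where
    open Algebra.Definitions _≈_
    open IsEquivalence isEquivalence

    mkCommutativeRing :
      Congruent₂ _+_ → Associative _+_ → Commutative _+_ → LeftIdentity 0# _+_ →
      Congruent₁ -_ → LeftInverse 0# -_ _+_ →
      Congruent₂ _*_ → Associative _*_ → Commutative _*_ → LeftIdentity 1# _*_ →
      _*_ DistributesOverˡ _+_ → CommutativeRing c ℓ
    mkCommutativeRing +-cong +-assoc +-comm +-idˡ neg-cong neg-invˡ *-cong *-assoc *-comm *-idˡ distribˡ = record
      { isCommutativeRing = record
        { isRing = record
          { +-isAbelianGroup = record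
            { isGroup = record
              { isMonoid = record
                { isSemigroup = record
                  { isMagma = record { isEquivalence = isEquivalence ; ∙-cong = +-cong }
                  ; assoc = +-assoc }
                ; identity = +-idˡ , λ x → trans (+-comm x 0#) (+-idˡ x) }
              ; inverse = neg-invˡ , λ x → trans (+-comm x (- x)) (neg-invˡ x)
              ; ⁻¹-cong = neg-cong }
            ; comm = +-comm }
          ; *-cong = *-cong
          ; *-assoc = *-assoc
          ; *-identity = *-idˡ , λ x → trans (*-comm x 1#) (*-idˡ x)
          ; distrib = distribˡ , λ x y z → trans (*-comm (y + z) x)
              (trans (distribˡ x y z) (+-cong (*-comm x y) (*-comm x z))) }
        ; *-comm = *-comm } }

  record Hom (R S : CommutativeRing c ℓ) : Set (c ⊔ ℓ) where
    private
      module R = CommutativeRing R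
      module S = CommutativeRing S
      module G = Algebra.Properties.Group (AbelianGroup.group S.+-abelianGroup)
    field
      ⟪_⟫    : R.Carrier → S.Carrier
      ⟪⟫-cong   : ∀ {x y} → x R.≈ y → ⟪ x ⟫ S.≈ ⟪ y ⟫
      +-homo : ∀ x y → ⟪ x R.+ y ⟫ S.≈ ⟪ x ⟫ S.+ ⟪ y ⟫
      *-homo : ∀ x y → ⟪ x R.* y ⟫ S.≈ ⟪ x ⟫ S.* ⟪ y ⟫
      1-homo : ⟪ R.1# ⟫ S.≈ S.1#

    0-homo : ⟪ R.0# ⟫ S.≈ S.0#
    0-homo = G.identityʳ-unique ⟪ R.0# ⟫ ⟪ R.0# ⟫
      (S.trans (S.sym (+-homo R.0# R.0#)) (⟪⟫-cong (R.+-identityˡ R.0#)))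

    -‿homo : ∀ x → ⟪ R.- x ⟫ S.≈ S.- ⟪ x ⟫
    -‿homo x = G.inverseʳ-unique ⟪ x ⟫ ⟪ R.- x ⟫
      (S.trans (S.sym (+-homo x (R.- x))) (S.trans (⟪⟫-cong (R.-‿inverseʳ x)) 0-homo))

    homo-char2 : Char2 R → Char2 S
    homo-char2 two≈0 = S.trans (S.+-cong (S.sym 1-homo) (S.sym 1-homo))
      (S.trans (S.sym (+-homo R.1# R.1#)) (S.trans (⟪⟫-cong two≈0) 0-homo))

  module Sum (R : CommutativeRing c ℓ) where
    open Algebra.Properties.Semiring.Sum (CommutativeRing.semiring R) public
    open CommutativeRing R using (Carrier; _≈_; 0#; trans)

    sum-zero : ∀ {n} (f : Fin n → Carrier) → (∀ i → f i ≈ 0#) → sum f ≈ 0#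
    sum-zero {n} f f≈0 = trans (sum-cong-≋ f≈0) (sum-replicate-zero n)

  homo-sum : ∀ {R S} (φ : Hom R S) → let open Hom φ in
    ∀ {n} (f : Fin n → CommutativeRing.Carrier R) →
    CommutativeRing._≈_ S ⟪ Sum.sum R f ⟫ (Sum.sum S (λ i → ⟪ f i ⟫))
  homo-sum φ {zero} f = Hom.0-homo φ
  homo-sum {S = S} φ {suc n} f =
    trans (Hom.+-homo φ _ _) (+-congˡ (homo-sum φ (f ∘ suc)))
    where open CommutativeRing S hiding (zero)

  module Char2Ring (R : CommutativeRing c ℓ) (two≈0 : Char2 R) where
    open CommutativeRing R hiding (zero)
    open Algebra.Properties.Group (AbelianGroup.group +-abelianGroup) using (inverseʳ-unique)

    x+x≈0 : ∀ x → x + x ≈ 0#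
    x+x≈0 x = trans (+-cong (sym (*-identityˡ x)) (sym (*-identityˡ x)))
      (trans (sym (distribʳ x 1# 1#)) (trans (*-congʳ two≈0) (zeroˡ x)))

    -x≈x : ∀ x → - x ≈ x
    -x≈x x = sym (inverseʳ-unique x x (x+x≈0 x))

    x+y≈0⇒x≈y : ∀ {x y} → x + y ≈ 0# → x ≈ y
    x+y≈0⇒x≈y {x} {y} eq = trans (inverseʳ-unique y x (trans (+-comm y x) eq)) (-x≈x y)

    private
      F₂ = CommutativeRing.rawRing Bool.xor-∧-commutativeRing

      ⟦_⟧₂ : Bool → Carrier
      ⟦ true ⟧₂ = 1#
      ⟦ false ⟧₂ = 0#

      F₂⟶R : F₂ -Raw-AlmostCommutative⟶ fromCommutativeRing R
      F₂⟶R = record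
        { ⟦_⟧ = ⟦_⟧₂
        ; +-homo = λ { true true → sym two≈0 ; true false → sym (+-identityʳ 1#)
                     ; false y → sym (+-identityˡ ⟦ y ⟧₂) }
        ; *-homo = λ { true y → sym (*-identityˡ ⟦ y ⟧₂) ; false y → sym (zeroˡ ⟦ y ⟧₂) }
        ; -‿homo = λ b → sym (-x≈x ⟦ b ⟧₂)
        ; 0-homo = refl
        ; 1-homo = refl }

      _≟₂_ : ∀ x y → Maybe (⟦ x ⟧₂ ≈ ⟦ y ⟧₂)
      x ≟₂ y with x Bool.≟ y
      ... | yes ≡.refl = just refl
      ... | no _ = nothing

    -- With coefficients in F₂ the solver normalises `x + x` to zero, so it proves identities that
    -- hold only in characteristic 2.
    module Solver = Algebra.Solver.Ring F₂ (fromCommutativeRing R) F₂⟶R _≟₂_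

  Mat : CommutativeRing c ℓ → ℕ → Set c
  Mat R n = Fin n → Fin n → CommutativeRing.Carrier R

  module Determinant (R : CommutativeRing c ℓ) where
    open CommutativeRing R hiding (zero)
    open Sum R
    open Relation.Binary.Reasoning.Setoid setoid
    private
      module S = Algebra.Solver.Ring.NaturalCoefficients.Default commutativeSemiring
      open S using (_:=_; _:+_; _:*_)

    -- The Laplace expansion without signs, which is the determinant in characteristic 2.
    unsignedDet : ∀ {n} → Mat R n → Carrier
    unsignedDet {zero} M = 1#
    unsignedDet {suc n} M =
      sum (λ j → M zero j * unsignedDet (λ r s → M (suc r) (punchIn j s)))

    unsignedDet-cong : ∀ {n} {M N : Mat R n} → (∀ i j → M i j ≈ N i j) → unsignedDet M ≈ unsignedDet N
    unsignedDet-cong {zero} M≈N = refl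
    unsignedDet-cong {suc n} M≈N = sum-cong-≋ λ j →
      *-cong (M≈N zero j) (unsignedDet-cong λ r s → M≈N (suc r) (punchIn j s))

    private
      doubleMinor : ∀ {n} → Mat R (suc (suc n)) → Fin (suc n) → Fin (suc n) → Carrier
      doubleMinor M i j = unsignedDet (λ r s → M (suc (punchIn i r)) (suc (punchIn j s)))

    interleaved mutual
      -- Expansion by the first row and expansion by the first column both lead to the double
      -- expansion of `expandRowColumn`, which treats rows and columns alike. The double expansion
      -- at one size rests on `expandColumn` at the size below.
      expandColumn : ∀ {n} (M : Mat R (suc n)) →
        unsignedDet M ≈ sum (λ i → M i zero * unsignedDet (λ r s → M (punchIn i r) (suc s)))

      expandRowColumn : ∀ {n} (M : Mat R (suc (suc n))) →
        unsignedDet M ≈ M zero zero * unsignedDet (λ r s → M (suc r) (suc s))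
          + sum (λ j → sum (λ i → M zero (suc j) * (M (suc i) zero * doubleMinor M i j)))

      expandRowColumn M = +-congˡ (sum-cong-≋ λ j →
        trans (*-congˡ (expandColumn (λ r s → M (suc r) (punchIn (suc j) s))))
              (*-distribˡ-sum (M zero (suc j)) (λ i → M (suc i) zero * doubleMinor M i j)))

      expandColumn {zero} M = refl
      expandColumn {suc n} M = begin
        unsignedDet M
          ≈⟨ expandRowColumn M ⟩
        _ + sum (λ j → sum (λ i → M zero (suc j) * (M (suc i) zero * doubleMinor M i j)))
          ≈⟨ +-congˡ (∑-comm (λ j i → M zero (suc j) * (M (suc i) zero * doubleMinor M i j))) ⟩
        _ + sum (λ i → sum (λ j → M zero (suc j) * (M (suc i) zero * doubleMinor M i j)))
          ≈⟨ +-congˡ (sum-cong-≋ λ i → sum-cong-≋ λ j →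
               S.solve 3 (λ a b d → a :* (b :* d) := b :* (a :* d)) refl
                 (M zero (suc j)) (M (suc i) zero) (doubleMinor M i j)) ⟩
        _ + sum (λ i → sum (λ j → M (suc i) zero * (M zero (suc j) * doubleMinor M i j)))
          ≈⟨ +-congˡ (sum-cong-≋ λ i →
               *-distribˡ-sum (M (suc i) zero) (λ j → M zero (suc j) * doubleMinor M i j)) ⟨
        sum (λ i → M i zero * unsignedDet (λ r s → M (punchIn i r) (suc s))) ∎

    unsignedDet-transpose : ∀ {n} (M : Mat R n) → unsignedDet (λ i j → M j i) ≈ unsignedDet M
    unsignedDet-transpose {zero} M = refl
    unsignedDet-transpose {suc n} M = trans
      (sum-cong-≋ λ j → *-congˡ {M j zero} (unsignedDet-transpose (λ r s → M (punchIn j r) (suc s))))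
      (sym (expandColumn M))

    module _ (two≈0 : Char2 R) where
      open Char2Ring R two≈0 using (x+x≈0)

      -- The terms at (i, j) and (j, i) are equal and cancel for i ≠ j.
      sum-symmetric : ∀ {n} (f : Fin n → Fin n → Carrier) → (∀ i j → f i j ≈ f j i) →
        sum (λ i → sum (f i)) ≈ sum (λ i → f i i)
      sum-symmetric {zero} f f-sym = refl
      sum-symmetric {suc n} f f-sym = begin
        (f zero zero + row) + sum (λ i → f (suc i) zero + sum (f (suc i) ∘ suc))
          ≈⟨ +-congˡ (∑-distrib-+ (λ i → f (suc i) zero) (λ i → sum (f (suc i) ∘ suc))) ⟩
        (f zero zero + row) + (sum (λ i → f (suc i) zero) + sum (λ i → sum (f (suc i) ∘ suc)))
          ≈⟨ +-congˡ (+-cong (sum-cong-≋ λ i → f-sym (suc i) zero)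
               (sum-symmetric (λ i j → f (suc i) (suc j)) (λ i j → f-sym (suc i) (suc j)))) ⟩
        (f zero zero + row) + (row + diagonal)
          ≈⟨ S.solve 3 (λ a b d → (a :+ b) :+ (b :+ d) := (b :+ b) :+ (a :+ d)) refl
               (f zero zero) row diagonal ⟩
        (row + row) + (f zero zero + diagonal)
          ≈⟨ trans (+-congʳ (x+x≈0 row)) (+-identityˡ _) ⟩
        f zero zero + diagonal ∎
        where
        row = sum (λ j → f zero (suc j))
        diagonal = sum (λ i → f (suc i) (suc i))

      -- Minors of a symmetric matrix at (i, j) and (j, i) are transposes of each other, so the
      -- double expansion is symmetric in i and j and only i = j survives. The result is the
      -- recursion for involutions: index 0 is either fixed or exchanged with one j.
      expandSymmetric : ∀ {n} (M : Mat R (suc (suc n))) → (∀ i j → M i j ≈ M j i) →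
        unsignedDet M ≈ M zero zero * unsignedDet (λ r s → M (suc r) (suc s))
          + sum (λ j → (M zero (suc j) * M zero (suc j)) * doubleMinor M j j)
      expandSymmetric M M-sym = trans (expandRowColumn M) (+-congˡ (begin
        sum (λ j → sum (λ i → M zero (suc j) * (M (suc i) zero * doubleMinor M i j)))
          ≈⟨ sum-symmetric (λ j i → M zero (suc j) * (M (suc i) zero * doubleMinor M i j)) term-sym ⟩
        sum (λ j → M zero (suc j) * (M (suc j) zero * doubleMinor M j j))
          ≈⟨ sum-cong-≋ (λ j → trans (*-congˡ {M zero (suc j)} (*-congʳ {doubleMinor M j j} (M-sym (suc j) zero)))
               (sym (*-assoc (M zero (suc j)) (M zero (suc j)) (doubleMinor M j j)))) ⟩
        sum (λ j → (M zero (suc j) * M zero (suc j)) * doubleMinor M j j) ∎))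
        where
        minor-sym : ∀ i j → doubleMinor M i j ≈ doubleMinor M j i
        minor-sym i j = trans
          (unsignedDet-cong λ r s → M-sym (suc (punchIn i r)) (suc (punchIn j s)))
          (unsignedDet-transpose (λ r s → M (suc (punchIn j r)) (suc (punchIn i s))))
        term-sym : ∀ j i → M zero (suc j) * (M (suc i) zero * doubleMinor M i j)
                         ≈ M zero (suc i) * (M (suc j) zero * doubleMinor M j i)
        term-sym j i = trans
          (*-cong (M-sym zero (suc j)) (*-cong (M-sym (suc i) zero) (minor-sym i j)))
          (S.solve 3 (λ a b d → a :* (b :* d) := b :* (a :* d)) refl
            (M (suc j) zero) (M zero (suc i)) (doubleMinor M j i))

-- Quadratic extensions

module _ {c ℓ : Level} where

  idHom : ∀ {R : CommutativeRing c ℓ} → Hom R R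
  idHom {R} = record
    { ⟪_⟫ = id ; ⟪⟫-cong = id ; +-homo = λ _ _ → refl ; *-homo = λ _ _ → refl ; 1-homo = refl }
    where open CommutativeRing R

  infixr 9 _∘ʰ_
  _∘ʰ_ : ∀ {R S T : CommutativeRing c ℓ} → Hom S T → Hom R S → Hom R T
  _∘ʰ_ {T = T} ψ φ = record
    { ⟪_⟫ = ψ.⟪_⟫ ∘ φ.⟪_⟫
    ; ⟪⟫-cong = ψ.⟪⟫-cong ∘ φ.⟪⟫-cong
    ; +-homo = λ x y → trans (ψ.⟪⟫-cong (φ.+-homo x y)) (ψ.+-homo _ _)
    ; *-homo = λ x y → trans (ψ.⟪⟫-cong (φ.*-homo x y)) (ψ.*-homo _ _)
    ; 1-homo = trans (ψ.⟪⟫-cong φ.1-homo) ψ.1-homo }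
    where
    module ψ = Hom ψ
    module φ = Hom φ
    open CommutativeRing T

  module _ (R : CommutativeRing c ℓ) (s : CommutativeRing.Carrier R) where
    open CommutativeRing R hiding (zero)
    private
      module S = Algebra.Solver.Ring.NaturalCoefficients.Default commutativeSemiring
      open S using (_:=_; _:+_; _:*_; con)

    -- R[θ] with θ² = s; the pair (a , b) stands for a + b θ.
    Quad : CommutativeRing c ℓ
    Quad = mkCommutativeRing
      {_≈_ = λ { (a , b) (a′ , b′) → (a ≈ a′) × (b ≈ b′) }}
      (record { refl = refl , refl ; sym = λ (p , q) → sym p , sym q
              ; trans = λ (p , q) (p′ , q′) → trans p p′ , trans q q′ })
      (λ (a , b) (a′ , b′) → a + a′ , b + b′)
      (λ (a , b) (a′ , b′) → a * a′ + s * (b * b′) , a * b′ + b * a′)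
      (λ (a , b) → - a , - b)
      (0# , 0#)
      (1# , 0#)
      (λ (p , q) (p′ , q′) → +-cong p p′ , +-cong q q′)
      (λ (a , b) (a′ , b′) (a″ , b″) → +-assoc a a′ a″ , +-assoc b b′ b″)
      (λ (a , b) (a′ , b′) → +-comm a a′ , +-comm b b′)
      (λ (a , b) → +-identityˡ a , +-identityˡ b)
      (λ (p , q) → -‿cong p , -‿cong q)
      (λ (a , b) → -‿inverseˡ a , -‿inverseˡ b)
      (λ (p , q) (p′ , q′) → +-cong (*-cong p p′) (*-congˡ (*-cong q q′)) , +-cong (*-cong p q′) (*-cong q p′))
      (λ (a , b) (a′ , b′) (a″ , b″) →
          S.solve 7 (λ a b a′ b′ a″ b″ s →
            (a :* a′ :+ s :* (b :* b′)) :* a″ :+ s :* ((a :* b′ :+ b :* a′) :* b″)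
            := a :* (a′ :* a″ :+ s :* (b′ :* b″)) :+ s :* (b :* (a′ :* b″ :+ b′ :* a″)))
            refl a b a′ b′ a″ b″ s
        , S.solve 7 (λ a b a′ b′ a″ b″ s →
            (a :* a′ :+ s :* (b :* b′)) :* b″ :+ (a :* b′ :+ b :* a′) :* a″
            := a :* (a′ :* b″ :+ b′ :* a″) :+ b :* (a′ :* a″ :+ s :* (b′ :* b″)))
            refl a b a′ b′ a″ b″ s)
      (λ (a , b) (a′ , b′) → +-cong (*-comm a a′) (*-congˡ (*-comm b b′))
        , trans (+-comm _ _) (+-cong (*-comm b a′) (*-comm a b′)))
      (λ (a , b) →
          S.solve 3 (λ a b s → con 1 :* a :+ s :* (con 0 :* b) := a) refl a b s
        , S.solve 2 (λ a b → con 1 :* b :+ con 0 :* a := b) refl a b)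
      (λ (a , b) (a′ , b′) (a″ , b″) →
          S.solve 7 (λ a b a′ b′ a″ b″ s →
            a :* (a′ :+ a″) :+ s :* (b :* (b′ :+ b″))
            := (a :* a′ :+ s :* (b :* b′)) :+ (a :* a″ :+ s :* (b :* b″)))
            refl a b a′ b′ a″ b″ s
        , S.solve 6 (λ a b a′ b′ a″ b″ →
            a :* (b′ :+ b″) :+ b :* (a′ :+ a″) := (a :* b′ :+ b :* a′) :+ (a :* b″ :+ b :* a″))
            refl a b a′ b′ a″ b″)

    embed : Hom R Quad
    embed = record
      { ⟪_⟫ = λ a → a , 0#
      ; ⟪⟫-cong = λ p → p , refl
      ; +-homo = λ _ _ → refl , sym (+-identityˡ 0#)
      ; *-homo = λ a b →
            S.solve 3 (λ a b s → a :* b := a :* b :+ s :* (con 0 :* con 0)) refl a b s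
          , S.solve 2 (λ a b → con 0 := a :* con 0 :+ con 0 :* b) refl a b
      ; 1-homo = refl , refl }

    module _ {S : CommutativeRing c ℓ} (φ : Hom R S) where
      private
        module S′ = CommutativeRing S
        module φ = Hom φ
        module N = Algebra.Solver.Ring.NaturalCoefficients.Default S′.commutativeSemiring

      quadEval : (t : S′.Carrier) → t S′.* t S′.≈ φ.⟪ s ⟫ → Hom Quad S
      quadEval t t²≈s = record
        { ⟪_⟫ = λ (a , b) → φ.⟪ a ⟫ S′.+ t S′.* φ.⟪ b ⟫
        ; ⟪⟫-cong = λ (p , q) → S′.+-cong (φ.⟪⟫-cong p) (S′.*-congˡ (φ.⟪⟫-cong q))
        ; +-homo = λ (a , b) (a′ , b′) → S′.trans
            (S′.+-cong (φ.+-homo a a′) (S′.*-congˡ (φ.+-homo b b′)))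
            (N.solve 5 (λ a b a′ b′ t → (a N.:+ a′) N.:+ t N.:* (b N.:+ b′)
              N.:= (a N.:+ t N.:* b) N.:+ (a′ N.:+ t N.:* b′)) S′.refl
              φ.⟪ a ⟫ φ.⟪ b ⟫ φ.⟪ a′ ⟫ φ.⟪ b′ ⟫ t)
        ; *-homo = λ (a , b) (a′ , b′) → S′.trans
            (S′.+-cong
              (S′.trans (φ.+-homo _ _) (S′.+-cong (φ.*-homo a a′)
                (S′.trans (φ.*-homo s _) (S′.*-cong (S′.sym t²≈s) (φ.*-homo b b′)))))
              (S′.*-congˡ (S′.trans (φ.+-homo _ _) (S′.+-cong (φ.*-homo a b′) (φ.*-homo b a′)))))
            (N.solve 5 (λ a b a′ b′ t →
              (a N.:* a′ N.:+ (t N.:* t) N.:* (b N.:* b′)) N.:+ t N.:* (a N.:* b′ N.:+ b N.:* a′)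
              N.:= (a N.:+ t N.:* b) N.:* (a′ N.:+ t N.:* b′)) S′.refl
              φ.⟪ a ⟫ φ.⟪ b ⟫ φ.⟪ a′ ⟫ φ.⟪ b′ ⟫ t)
        ; 1-homo = S′.trans (S′.+-cong φ.1-homo (S′.trans (S′.*-congˡ φ.0-homo) (S′.zeroʳ t)))
            (S′.+-identityʳ S′.1#) }

  quadMap : ∀ {R S : CommutativeRing c ℓ} (φ : Hom R S) {s : CommutativeRing.Carrier R}
    {t : CommutativeRing.Carrier S} →
    CommutativeRing._≈_ S (Hom.⟪_⟫ φ s) t → Hom (Quad R s) (Quad S t)
  quadMap {R} {S} φ {s} {t} s≈t = record
    { ⟪_⟫ = λ (a , b) → φ.⟪ a ⟫ , φ.⟪ b ⟫
    ; ⟪⟫-cong = λ (p , q) → φ.⟪⟫-cong p , φ.⟪⟫-cong q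
    ; +-homo = λ (a , b) (a′ , b′) → φ.+-homo a a′ , φ.+-homo b b′
    ; *-homo = λ (a , b) (a′ , b′) →
          trans (φ.+-homo _ _) (+-cong (φ.*-homo a a′)
            (trans (φ.*-homo s _) (*-cong s≈t (φ.*-homo b b′))))
        , trans (φ.+-homo _ _) (+-cong (φ.*-homo a b′) (φ.*-homo b a′))
    ; 1-homo = φ.1-homo , φ.0-homo }
    where
    module φ = Hom φ
    open CommutativeRing S

  constantTerm : ∀ {R : CommutativeRing c ℓ} → Hom (Quad R (CommutativeRing.0# R)) R
  constantTerm {R} = record
    { ⟪_⟫ = proj₁
    ; ⟪⟫-cong = proj₁
    ; +-homo = λ _ _ → refl
    ; *-homo = λ _ _ → trans (+-congˡ (zeroˡ _)) (+-identityʳ _)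
    ; 1-homo = refl }
    where open CommutativeRing R

-- Nilpotent variables and top coefficients

module _ {c ℓ : Level} where

  module Grassmann (R : CommutativeRing c ℓ) where
    private module R = CommutativeRing R
    open Sum R

    -- R[θ₀,…,θₙ₋₁] modulo all θᵢ², with θ₀ adjoined last.
    Grass : ℕ → CommutativeRing c ℓ
    Grass zero = R
    Grass (suc n) = Quad (Grass n) (CommutativeRing.0# (Grass n))

    private module G (n : ℕ) = CommutativeRing (Grass n)

    scalar : ∀ n → Hom R (Grass n)
    scalar zero = idHom
    scalar (suc n) = embed (Grass n) (G.0# n) ∘ʰ scalar n

    private module η (n : ℕ) = Hom (scalar n)

    -- The coefficient of θ₀⋯θₙ₋₁ (the Berezin integral).
    top : ∀ n → G.Carrier n → R.Carrier
    top zero x = x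
    top (suc n) (a , b) = top n b

    top-cong : ∀ n {x y} → G._≈_ n x y → top n x R.≈ top n y
    top-cong zero p = p
    top-cong (suc n) (p , q) = top-cong n q

    top-+ : ∀ n x y → top n (G._+_ n x y) R.≈ top n x R.+ top n y
    top-+ zero x y = R.refl
    top-+ (suc n) (a , b) (a′ , b′) = top-+ n b b′

    top-scalar* : ∀ n r x → top n (G._*_ n (η.⟪_⟫ n r) x) R.≈ r R.* top n x
    top-scalar* zero r x = R.refl
    top-scalar* (suc n) r (a , b) = R.trans
      (top-cong n (G.trans n (G.+-congˡ n (G.zeroˡ n a)) (G.+-identityʳ n _))) (top-scalar* n r b)

    -- The coefficient of the product of all θᵢ with i ≠ j.
    topWithout : ∀ n → Fin n → G.Carrier n → R.Carrier
    topWithout (suc n) zero (a , b) = top n a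
    topWithout (suc n) (suc j) (a , b) = topWithout n j b

    -- This is d + ∑ⱼ wⱼ θⱼ, with d kept in the innermost ring.
    linearForm : ∀ n → R.Carrier → (Fin n → R.Carrier) → G.Carrier n
    linearForm zero d w = d
    linearForm (suc n) d w = linearForm n d (w ∘ suc) , η.⟪_⟫ n (w zero)

    linearForm-cong : ∀ n {d d′ w w′} → d R.≈ d′ → (∀ j → w j R.≈ w′ j) →
      G._≈_ n (linearForm n d w) (linearForm n d′ w′)
    linearForm-cong zero p q = p
    linearForm-cong (suc n) p q = linearForm-cong n p (q ∘ suc) , η.⟪⟫-cong n (q zero)

    linearForm-+ : ∀ n d w d′ w′ → G._≈_ n (linearForm n (d R.+ d′) (λ j → w j R.+ w′ j))
      (G._+_ n (linearForm n d w) (linearForm n d′ w′))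
    linearForm-+ zero d w d′ w′ = R.refl
    linearForm-+ (suc n) d w d′ w′ =
      linearForm-+ n d (w ∘ suc) d′ (w′ ∘ suc) , η.+-homo n (w zero) (w′ zero)

    linearForm-* : ∀ n r d w → G._≈_ n (linearForm n (r R.* d) (λ j → r R.* w j))
      (G._*_ n (η.⟪_⟫ n r) (linearForm n d w))
    linearForm-* zero r d w = R.refl
    linearForm-* (suc n) r d w =
        trans (linearForm-* n r d (w ∘ suc)) (sym (trans (+-congˡ (zeroˡ _)) (+-identityʳ _)))
      , trans (η.*-homo n r (w zero)) (sym (trans (+-congˡ (zeroˡ _)) (+-identityʳ _)))
      where open CommutativeRing (Grass n) hiding (zero)

    linearForm-const : ∀ n d w → (∀ j → w j R.≈ R.0#) → G._≈_ n (linearForm n d w) (η.⟪_⟫ n d)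
    linearForm-const zero d w w≈0 = R.refl
    linearForm-const (suc n) d w w≈0 = linearForm-const n d (w ∘ suc) (w≈0 ∘ suc)
      , G.trans n (η.⟪⟫-cong n (w≈0 zero)) (η.0-homo n)

    -- A linear form supplies at most one θ: either none, and x supplies all of them, or θⱼ, and x
    -- supplies the others.
    top-linearForm* : ∀ n d w x → top n (G._*_ n (linearForm n d w) x)
      R.≈ d R.* top n x R.+ sum (λ j → w j R.* topWithout n j x)
    top-linearForm* zero d w x = R.sym (R.+-identityʳ _)
    top-linearForm* (suc n) d w (a , b) = begin
      top n (G._+_ n (G._*_ n (linearForm n d (w ∘ suc)) b) (G._*_ n (η.⟪_⟫ n (w zero)) a))
        ≈⟨ top-+ n _ _ ⟩
      top n (G._*_ n (linearForm n d (w ∘ suc)) b) R.+ top n (G._*_ n (η.⟪_⟫ n (w zero)) a)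
        ≈⟨ R.+-cong (top-linearForm* n d (w ∘ suc) b) (top-scalar* n (w zero) a) ⟩
      (d R.* top n b R.+ rest) R.+ w zero R.* top n a
        ≈⟨ R.trans (R.+-assoc _ _ _) (R.+-congˡ (R.+-comm _ _)) ⟩
      d R.* top n b R.+ (w zero R.* top n a R.+ rest) ∎
      where
      open Relation.Binary.Reasoning.Setoid R.setoid
      rest = sum (λ j → w (suc j) R.* topWithout n j b)

    setZero : ∀ n → Fin (suc n) → Hom (Grass (suc n)) (Grass n)
    setZero n zero = constantTerm {R = Grass n}
    setZero (suc n) (suc j) = quadMap {R = Grass (suc n)} {S = Grass n} (setZero n j) {s = G.0# (suc n)} {t = G.0# n} (Hom.0-homo (setZero n j))

    private module ρ (n : ℕ) (j : Fin (suc n)) = Hom (setZero n j)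

    -- Unlike `topWithout`, the map θⱼ ↦ 0 is a ring homomorphism and can be pushed through the
    -- product that forms `gaussian`.
    topWithout≡top∘setZero : ∀ n j x → topWithout (suc n) j x ≡ top n (ρ.⟪_⟫ n j x)
    topWithout≡top∘setZero n zero x = ≡.refl
    topWithout≡top∘setZero (suc n) (suc j) (a , b) = topWithout≡top∘setZero n j b

    setZero-scalar : ∀ n j x → G._≈_ n (ρ.⟪_⟫ n j (η.⟪_⟫ (suc n) x)) (η.⟪_⟫ n x)
    setZero-scalar n zero x = G.refl n
    setZero-scalar (suc n) (suc j) x = setZero-scalar n j x , ρ.0-homo n j

    setZero-linearForm : ∀ n j d w →
      G._≈_ n (ρ.⟪_⟫ n j (linearForm (suc n) d w)) (linearForm n d (w ∘ punchIn j))
    setZero-linearForm n zero d w = G.refl n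
    setZero-linearForm (suc n) (suc j) d w =
      setZero-linearForm n j d (w ∘ suc) , setZero-scalar n j (w zero)

    -- ∏ᵢ (1 + Mᵢᵢ θᵢ) ∏_{i<j} (1 + Mᵢⱼ² θᵢ θⱼ), of which the top coefficient counts the
    -- involutions in the Leibniz formula; the others cancel in pairs when M is symmetric.
    gaussian : ∀ n → Mat R n → G.Carrier n
    gaussian zero M = R.1#
    gaussian (suc n) M = rest , G._*_ n (linearForm n (M zero zero) (λ j → M zero (suc j) R.* M zero (suc j))) rest
      where rest = gaussian n (λ i j → M (suc i) (suc j))

    gaussian-cong : ∀ n {M N : Mat R n} → (∀ i j → M i j R.≈ N i j) →
      G._≈_ n (gaussian n M) (gaussian n N)
    gaussian-cong zero p = R.refl
    gaussian-cong (suc n) p = rest , G.*-cong n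
        (linearForm-cong n (p zero zero) (λ j → R.*-cong (p zero (suc j)) (p zero (suc j)))) rest
      where rest = gaussian-cong n (λ i j → p (suc i) (suc j))

    -- Setting θⱼ to zero turns exactly the factors that involve the index j into 1.
    setZero-gaussian : ∀ n j M → G._≈_ n (ρ.⟪_⟫ n j (gaussian (suc n) M))
      (gaussian n (λ r s → M (punchIn j r) (punchIn j s)))
    setZero-gaussian n zero M = G.refl n
    setZero-gaussian (suc n) (suc j) M = rest
      , G.trans n (ρ.*-homo n j _ _) (G.*-cong n (setZero-linearForm n j (M zero zero) (λ s → M zero (suc s) R.* M zero (suc s))) rest)
      where rest = setZero-gaussian n j (λ r s → M (suc r) (suc s))

    module _ (two≈0 : Char2 R) where
      open Determinant R

      -- As θ₀² = 0, the factors of `gaussian` that involve θ₀ multiply to 1 + θ₀ (M₀₀ + ∑ⱼ M₀ⱼ²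
      -- θⱼ). The top coefficient therefore obeys the recursion of `expandSymmetric`: choosing M₀ⱼ²
      -- θ₀ θⱼ uses up θⱼ, and what remains is `gaussian` with the index j deleted.
      unsignedDet≈top : ∀ n (M : Mat R n) → (∀ i j → M i j R.≈ M j i) →
        unsignedDet M R.≈ top n (gaussian n M)
      unsignedDet≈top zero M M-sym = R.refl
      unsignedDet≈top (suc zero) M M-sym = R.+-identityʳ _
      unsignedDet≈top (suc (suc n)) M M-sym = begin
        unsignedDet M
          ≈⟨ expandSymmetric two≈0 M M-sym ⟩
        M zero zero R.* unsignedDet N
          R.+ sum (λ j → w j R.* unsignedDet (λ r s → N (punchIn j r) (punchIn j s)))
          ≈⟨ R.+-cong (R.*-congˡ (unsignedDet≈top (suc n) N (λ i j → M-sym (suc i) (suc j))))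
               (sum-cong-≋ λ j → R.*-congˡ {w j} (begin
                 unsignedDet (λ r s → N (punchIn j r) (punchIn j s))
                   ≈⟨ unsignedDet≈top n _ (λ r s → M-sym (suc (punchIn j r)) (suc (punchIn j s))) ⟩
                 top n (gaussian n (λ r s → N (punchIn j r) (punchIn j s)))
                   ≈⟨ top-cong n (setZero-gaussian n j N) ⟨
                 top n (ρ.⟪_⟫ n j (gaussian (suc n) N))
                   ≡⟨ topWithout≡top∘setZero n j (gaussian (suc n) N) ⟨
                 topWithout (suc n) j (gaussian (suc n) N) ∎)) ⟩
        M zero zero R.* top (suc n) (gaussian (suc n) N)
          R.+ sum (λ j → w j R.* topWithout (suc n) j (gaussian (suc n) N))
          ≈⟨ top-linearForm* (suc n) (M zero zero) w (gaussian (suc n) N) ⟨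
        top (suc (suc n)) (gaussian (suc (suc n)) M) ∎
        where
        open Relation.Binary.Reasoning.Setoid R.setoid
        N = λ i j → M (suc i) (suc j)
        w = λ j → M zero (suc j) R.* M zero (suc j)

      private
        module Char2G (n : ℕ) = Char2Ring (Grass n) (Hom.homo-char2 (scalar n) two≈0)

      -- Cross terms are doubled and each θⱼ squares to zero, so only the square of the constant 1
      -- is left.
      linearForm-square : ∀ n w → let e = linearForm n R.1# w in G._≈_ n (G._*_ n e e) (G.1# n)
      linearForm-square zero w = R.*-identityˡ R.1#
      linearForm-square (suc n) w =
          trans (+-cong (linearForm-square n (w ∘ suc)) (zeroˡ _)) (+-identityʳ 1#)
        , trans (+-congˡ (*-comm _ _)) (Char2G.x+x≈0 n _)
        where open CommutativeRing (Grass n) hiding (zero)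

      -- Since θᵢ² = 0, the factors of `gaussian` turn sums of diagonal entries, and sums of squared
      -- off-diagonal entries, into products. As squaring is additive, x v vᵀ contributes a factor
      -- of its own. With cⱼ = x vⱼ² it is ∏ᵢ (1 + cᵢθᵢ) ∏_{i<j} (1 + cᵢcⱼθᵢθⱼ), which collapses to
      -- a linear form as in (1 + aθ₁)(1 + bθ₂)(1 + abθ₁θ₂) = 1 + aθ₁ + bθ₂.
      gaussian-rankOne : ∀ n (N : Mat R n) (x : R.Carrier) (v : Fin n → R.Carrier) →
        G._≈_ n (gaussian n (λ i j → N i j R.+ (x R.* v i) R.* v j))
                (G._*_ n (linearForm n R.1# (λ j → x R.* (v j R.* v j))) (gaussian n N))
      gaussian-rankOne zero N x v = R.sym (R.*-identityˡ R.1#)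
      gaussian-rankOne (suc n) N x v =
          trans rest (sym (trans (+-congˡ (zeroˡ _)) (+-identityʳ _)))
        , (begin
          linearForm n _ _ * gaussian n _
            ≈⟨ *-cong split rest ⟩
          (lam + y * e) * (e * g)
            ≈⟨ solve 4 (λ lam y e g → (lam :+ y :* e) :* (e :* g) := e :* (lam :* g) :+ y :* ((e :* e) :* g))
                 refl lam y e g ⟩
          e * (lam * g) + y * ((e * e) * g)
            ≈⟨ +-congˡ (*-congˡ (trans (*-congʳ (linearForm-square n _)) (*-identityˡ g))) ⟩
          e * (lam * g) + y * g ∎)
        where
        open CommutativeRing (Grass n) hiding (zero)
        open Relation.Binary.Reasoning.Setoid setoid
        open Algebra.Solver.Ring.NaturalCoefficients.Default commutativeSemiring
        N′ = λ i j → N (suc i) (suc j)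
        u = λ j → v j R.* v j
        e = linearForm n R.1# (λ j → x R.* u (suc j))
        g = gaussian n N′
        y = η.⟪_⟫ n (x R.* u zero)
        lam = linearForm n (N zero zero) (λ j → N zero (suc j) R.* N zero (suc j))
        rest = gaussian-rankOne n N′ x (v ∘ suc)
        -- The added part of the first row is y times the form e of the remaining indices: the
        -- diagonal entry x v₀² is y times the constant 1 of e, and (x v₀ vⱼ)² is y times its weight
        -- x vⱼ².
        split : linearForm n (N zero zero R.+ (x R.* v zero) R.* v zero)
          (λ j → (N zero (suc j) R.+ (x R.* v zero) R.* v (suc j)) R.* (N zero (suc j) R.+ (x R.* v zero) R.* v (suc j)))
          ≈ lam + y * e
        split = trans (linearForm-cong n
            (S.solve 3 (λ d x v → d S.:+ (x S.:* v) S.:* v S.:= d S.:+ (x S.:* (v S.:* v)) S.:* S.con true)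
              R.refl (N zero zero) x (v zero))
            (λ j → S.solve 4 (λ a x v w →
                (a S.:+ (x S.:* v) S.:* w) S.:* (a S.:+ (x S.:* v) S.:* w)
                S.:= a S.:* a S.:+ (x S.:* (v S.:* v)) S.:* (x S.:* (w S.:* w)))
              R.refl (N zero (suc j)) x (v zero) (v (suc j))))
          (trans (linearForm-+ n _ _ _ _) (+-congˡ (linearForm-* n (x R.* u zero) R.1# _)))
          where
          module S = Char2Ring.Solver R two≈0


-- For z = 0 and o = 1 the upper left block has determinant 1 in characteristic 2, and its Schur
-- complement is N + x v vᵀ. The type of the entries is left open so that one definition serves for
-- matrices of `Entry` and for their images in a ring.
border : ∀ {x} {X : Set x} {n} → X → X → X → (Fin n → X) → (Fin n → Fin n → X) →
  Fin (suc (suc n)) → Fin (suc (suc n)) → X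
border z o x v N zero zero = z
border z o x v N zero (suc zero) = o
border z o x v N zero (suc (suc j)) = v j
border z o x v N (suc zero) zero = o
border z o x v N (suc zero) (suc zero) = x
border z o x v N (suc zero) (suc (suc j)) = z
border z o x v N (suc (suc i)) zero = v i
border z o x v N (suc (suc i)) (suc zero) = z
border z o x v N (suc (suc i)) (suc (suc j)) = N i j

module _ {c ℓ : Level} where

  module _ (R : CommutativeRing c ℓ) where
    private module R = CommutativeRing R
    open Grassmann R
    open Algebra.Properties.CommutativeMonoid.Sum R.*-commutativeMonoid using () renaming (sum to product)

    -- There are two ways to obtain θ₀θ₁: they are paired through the entry 1, or θ₁ comes with the
    -- diagonal entry x while θ₀ is paired with some θⱼ through vⱼ. Together they give 1 + x ∑ⱼ vⱼ²
    -- θⱼ, the factor by which `gaussian-rankOne` accounts for x v vᵀ.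
    top-gaussian-border : Char2 R → ∀ {n} (x : R.Carrier) (v : Fin n → R.Carrier) (N : Mat R n) →
      top (suc (suc n)) (gaussian (suc (suc n)) (border R.0# R.1# x v N))
      R.≈ top n (gaussian n (λ i j → N i j R.+ (x R.* v i) R.* v j))
    top-gaussian-border two≈0 {n} x v N = top-cong n (begin
      b * (linearForm n x (λ _ → R.0# R.* R.0#) * g) + η.⟪ R.1# R.* R.1# ⟫ * g
        ≈⟨ +-cong (*-congˡ (*-congʳ (linearForm-const n x _ (λ _ → R.zeroˡ R.0#))))
             (*-congʳ (trans (η.⟪⟫-cong (R.*-identityˡ R.1#)) η.1-homo)) ⟩
      b * (η.⟪ x ⟫ * g) + 1# * g
        ≈⟨ solve 3 (λ b x g → b :* (x :* g) :+ con 1 :* g := (x :* b :+ con 1) :* g) refl b η.⟪ x ⟫ g ⟩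
      (η.⟪ x ⟫ * b + 1#) * g
        ≈⟨ *-congʳ form ⟨
      linearForm n R.1# (λ j → x R.* u j) * g
        ≈⟨ gaussian-rankOne two≈0 n N x v ⟨
      gaussian n (λ i j → N i j R.+ (x R.* v i) R.* v j) ∎)
      where
      open CommutativeRing (Grass n) hiding (zero)
      open Relation.Binary.Reasoning.Setoid setoid
      open Algebra.Solver.Ring.NaturalCoefficients.Default commutativeSemiring
      module η = Hom (scalar n)
      u = λ j → v j R.* v j
      b = linearForm n R.0# u
      g = gaussian n N
      form : linearForm n R.1# (λ j → x R.* u j) ≈ η.⟪ x ⟫ * b + 1#
      form = trans (linearForm-cong n
          (R.sym (R.trans (R.+-congʳ (R.zeroʳ x)) (R.+-identityˡ R.1#))) (λ j → R.sym (R.+-identityʳ _)))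
        (trans (linearForm-+ n (x R.* R.0#) _ R.1# (λ _ → R.0#))
          (+-cong (linearForm-* n x R.0# u)
            (trans (linearForm-const n R.1# _ (λ _ → R.refl)) η.1-homo)))

    -- Off-diagonal entries enter `gaussian` only through their squares, so nilpotent entries of
    -- square zero count as zeros.
    top-gaussian-diagonal : ∀ n (M : Mat R n) → (∀ i j → i ≢ j → M i j R.* M i j R.≈ R.0#) →
      top n (gaussian n M) R.≈ product (λ i → M i i)
    top-gaussian-diagonal zero M off = R.refl
    top-gaussian-diagonal (suc n) M off = R.trans
      (top-cong n (G.*-congʳ (linearForm-const n _ _ (λ j → off zero (suc j) λ ()))))
      (R.trans (top-scalar* n (M zero zero) _)
        (R.*-congˡ (top-gaussian-diagonal n _ (λ i j i≢j → off (suc i) (suc j) λ { ≡.refl → i≢j ≡.refl }))))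
      where module G = CommutativeRing (Grass n)

-- Products of linear elements

module _ {c ℓ : Level} where

  module FiniteChar2 (F : CommutativeRing c ℓ) (finite : IsFiniteField F) (two≈0 : Char2 F) where
    open IsFiniteField finite using (inverse; to; from; to-cong; from-to)
    private module F = CommutativeRing F

    _≟F_ : ∀ x y → Dec (x F.≈ y)
    x ≟F y with to x Fin.≟ to y
    ... | yes p = yes (F.trans (F.sym (from-to x)) (F.trans (F.reflexive (≡.cong from p)) (from-to y)))
    ... | no ¬p = no (¬p ∘ to-cong)

    -- The properties of R(ℓ²) that the factorization uses and that persist when θ is adjoined. By
    -- `square`, the elements of nonzero residue are units and those of residue zero have square
    -- zero.
    record Linearity (R : CommutativeRing c ℓ) : Set (Level.suc (c ⊔ ℓ)) where
      open CommutativeRing R hiding (zero)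
      field
        constant : Hom F R
        residue  : Hom R F
      module κ = Hom constant
      module ρ = Hom residue
      field
        residue-constant : ∀ a → ρ.⟪ κ.⟪ a ⟫ ⟫ F.≈ a
        square           : ∀ x → x * x ≈ κ.⟪ ρ.⟪ x ⟫ F.* ρ.⟪ x ⟫ ⟫
        Linear           : Carrier → Set (c ⊔ ℓ)
        Linear-resp      : ∀ {x y} → x ≈ y → Linear x → Linear y
        Linear-+         : ∀ {x y} → Linear x → Linear y → Linear (x + y)
        Linear-constant  : ∀ a → Linear κ.⟪ a ⟫
        Linear-scale     : ∀ a {x} → Linear x → Linear (κ.⟪ a ⟫ * x)

      char2 : Char2 R
      char2 = κ.homo-char2 two≈0

      Linear-0# : Linear 0#
      Linear-0# = Linear-resp κ.0-homo (Linear-constant F.0#)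

      Linear-1# : Linear 1#
      Linear-1# = Linear-resp κ.1-homo (Linear-constant F.1#)

      residue≈0⇒square≈0 : ∀ {x} → ρ.⟪ x ⟫ F.≈ F.0# → x * x ≈ 0#
      residue≈0⇒square≈0 {x} p =
        trans (square x) (trans (κ.⟪⟫-cong (F.trans (F.*-congʳ p) (F.zeroˡ _))) κ.0-homo)

    baseLinearity : Linearity F
    baseLinearity = record
      { constant = idHom
      ; residue = idHom
      ; residue-constant = λ _ → F.refl
      ; square = λ _ → F.refl
      ; Linear = λ _ → ⊤
      ; Linear-resp = λ _ _ → tt
      ; Linear-+ = λ _ _ → tt
      ; Linear-constant = λ _ → tt
      ; Linear-scale = λ _ _ → tt }

    module _ {R : CommutativeRing c ℓ} (L : Linearity R) where
      open CommutativeRing R hiding (zero)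
      open Linearity L
      open Char2Ring R char2
      open Solver

      module _ (t : F.Carrier) {s : Carrier} (s≈t² : s ≈ κ.⟪ t F.* t ⟫) where
        private
          module SF = Char2Ring.Solver F two≈0
          eval : Hom (Quad R s) F
          eval = quadEval R s residue t (F.sym (F.trans (ρ.⟪⟫-cong s≈t²) (residue-constant _)))

        -- For t = ℓᵢ this adjoins xᵢ, for t = 0 a nilpotent θ. The residue extends by θ ↦ t, and (a
        -- + bθ)² = a² + t²b² is the square of ρ(a) + tρ(b) because cross terms vanish.
        quadLinearity : Linearity (Quad R s)
        quadLinearity = record
          { constant = _∘ʰ_ {R = F} {S = R} {T = Quad R s} (embed R s) constant
          ; residue = eval
          ; residue-constant = λ a → F.trans
              (F.+-cong (residue-constant a) (F.trans (F.*-congˡ ρ.0-homo) (F.zeroʳ t))) (F.+-identityʳ a)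
          ; square = λ (a , b) →
                (begin
                  a * a + s * (b * b)
                    ≈⟨ +-cong (square a) (*-cong s≈t² (square b)) ⟩
                  κ.⟪ ρ.⟪ a ⟫ F.* ρ.⟪ a ⟫ ⟫ + κ.⟪ t F.* t ⟫ * κ.⟪ ρ.⟪ b ⟫ F.* ρ.⟪ b ⟫ ⟫
                    ≈⟨ +-congˡ (κ.*-homo _ _) ⟨
                  κ.⟪ ρ.⟪ a ⟫ F.* ρ.⟪ a ⟫ ⟫ + κ.⟪ (t F.* t) F.* (ρ.⟪ b ⟫ F.* ρ.⟪ b ⟫) ⟫
                    ≈⟨ κ.+-homo _ _ ⟨
                  κ.⟪ ρ.⟪ a ⟫ F.* ρ.⟪ a ⟫ F.+ (t F.* t) F.* (ρ.⟪ b ⟫ F.* ρ.⟪ b ⟫) ⟫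
                    ≈⟨ κ.⟪⟫-cong (SF.solve 3 (λ a b t →
                         a SF.:* a SF.:+ (t SF.:* t) SF.:* (b SF.:* b)
                         SF.:= (a SF.:+ t SF.:* b) SF.:* (a SF.:+ t SF.:* b))
                         F.refl ρ.⟪ a ⟫ ρ.⟪ b ⟫ t) ⟩
                  κ.⟪ (ρ.⟪ a ⟫ F.+ t F.* ρ.⟪ b ⟫) F.* (ρ.⟪ a ⟫ F.+ t F.* ρ.⟪ b ⟫) ⟫ ∎)
              , trans (+-congˡ (*-comm b a)) (x+x≈0 _)
          ; Linear = λ (a , b) → Linear a × ∃ λ e → b ≈ κ.⟪ e ⟫
          ; Linear-resp = λ { (p , q) (lin , e , r) → Linear-resp p lin , e , trans (sym q) r }
          ; Linear-+ = λ { (lin , e , r) (lin′ , e′ , r′) →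
              Linear-+ lin lin′ , e F.+ e′ , trans (+-cong r r′) (sym (κ.+-homo e e′)) }
          ; Linear-constant = λ a → Linear-constant a , F.0# , sym κ.0-homo
          ; Linear-scale = λ { a (lin , e , r) →
                Linear-resp (sym (trans (+-congˡ (trans (*-congˡ (zeroˡ _)) (zeroʳ s))) (+-identityʳ _)))
                  (Linear-scale a lin)
              , a F.* e
              , trans (+-cong (*-congˡ r) (zeroˡ _)) (trans (+-identityʳ _) (sym (κ.*-homo a e))) } }
          where open Relation.Binary.Reasoning.Setoid setoid

      data Factors : Carrier → Set (c ⊔ ℓ) where
        unit : ∀ {x} → x ≈ 1# → Factors x
        mul  : ∀ {x y z} → Linear y → Factors z → x ≈ y * z → Factors x

      Factors-resp : ∀ {x y} → x ≈ y → Factors x → Factors y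
      Factors-resp x≈y (unit p) = unit (trans (sym x≈y) p)
      Factors-resp x≈y (mul lin f p) = mul lin f (trans (sym x≈y) p)

      Factors-linear : ∀ {x} → Linear x → Factors x
      Factors-linear lin = mul lin (unit refl) (sym (*-identityʳ _))

      Factors-* : ∀ {x y} → Factors x → Factors y → Factors (x * y)
      Factors-* (unit p) g = Factors-resp (sym (trans (*-congʳ p) (*-identityˡ _))) g
      Factors-* (mul lin f p) g = mul lin (Factors-* f g) (trans (*-congʳ p) (*-assoc _ _ _))

      dropMultiple : ∀ {p} → p ≈ 0# → ∀ x y → x + p * y ≈ x
      dropMultiple p≈0 x y = trans (+-congˡ (trans (*-congʳ p≈0) (zeroˡ y))) (+-identityʳ x)

      -- (1 + x)(1 + y) = (1 + x + y) + xy. Multiplication by 1 + x + y, which squares to 1 and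
      -- fixes xy, leaves 1 + xy; so three linear factors suffice.
      Factors-1+nilpotents : ∀ {x y} → Linear x → Linear y → x * x ≈ 0# → y * y ≈ 0# → Factors (1# + x * y)
      Factors-1+nilpotents {x} {y} lin-x lin-y x²≈0 y²≈0 = Factors-resp
        (trans
          (solve 2 (λ x y → (con true :+ x) :* ((con true :+ y) :* ((con true :+ x) :+ y))
              := ((con true :+ x :* y) :+ (x :* x) :* (con true :+ y)) :+ (y :* y) :* (con true :+ x))
            refl x y)
          (trans (dropMultiple y²≈0 _ _) (dropMultiple x²≈0 _ _)))
        (Factors-* (Factors-linear (Linear-+ Linear-1# lin-x))
          (Factors-* (Factors-linear (Linear-+ Linear-1# lin-y))
            (Factors-linear (Linear-+ (Linear-+ Linear-1# lin-x) lin-y))))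

      -- Write β = b + β′ with b constant and β′² = 0. As α² = 0, 1 + βα = (1 + bα)(1 + β′α).
      Factors-1+product : ∀ {α β} → Linear α → Linear β → ρ.⟪ α ⟫ F.≈ F.0# → Factors (1# + β * α)
      Factors-1+product {α} {β} lin-α lin-β α-nil = Factors-resp
        (trans
          (solve 3 (λ α β b → (con true :+ b :* α) :* (con true :+ (β :+ b) :* α)
              := (con true :+ β :* α) :+ (α :* α) :* (b :* (β :+ b))) refl α β b)
          (dropMultiple α²≈0 _ _))
        (Factors-* (Factors-linear (Linear-+ Linear-1# (Linear-scale ρ.⟪ β ⟫ lin-α)))
          (Factors-1+nilpotents (Linear-+ lin-β (Linear-constant ρ.⟪ β ⟫)) lin-α β′²≈0 α²≈0))
        where
        b = κ.⟪ ρ.⟪ β ⟫ ⟫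
        β′²≈0 : (β + b) * (β + b) ≈ 0#
        β′²≈0 = residue≈0⇒square≈0 (F.trans (ρ.+-homo β b)
          (F.trans (F.+-congˡ (residue-constant ρ.⟪ β ⟫)) (Char2Ring.x+x≈0 F two≈0 ρ.⟪ β ⟫)))
        α²≈0 : α * α ≈ 0#
        α²≈0 = residue≈0⇒square≈0 α-nil

    module _ {R : CommutativeRing c ℓ} (L : Linearity R) where
      open CommutativeRing R hiding (zero)
      open Linearity L
      open Char2Ring R char2
      open Solver
      private
        Q = Quad R 0#
        module Q = CommutativeRing Q

      nilLinearity : Linearity Q
      nilLinearity = quadLinearity L F.0# {s = 0#}
        (trans (sym κ.0-homo) (κ.⟪⟫-cong (F.sym (F.zeroˡ F.0#))))

      private
        Factors-Q : Q.Carrier → Set (c ⊔ ℓ)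
        Factors-Q = Factors nilLinearity

      Factors-embed : ∀ {x} → Factors L x → Factors-Q (x , 0#)
      Factors-embed (unit p) = unit (p , refl)
      Factors-embed (mul lin f p) = mul (lin , F.0# , sym κ.0-homo) (Factors-embed f)
        (Q.trans (p , refl) (Hom.*-homo (embed R 0#) _ _))

      -- The pair is x (1 + yθ), and `Factors-1+product` applies to the second factor because θ has
      -- residue 0. Each step of `gaussian` has this shape.
      Factors-pair : ∀ {x y} → Factors L x → Linear y → Factors-Q (x , y * x)
      Factors-pair {x} {y} f lin = Factors-resp nilLinearity
        ( solve 3 (λ x y z → x :* (con true :+ (y :* con false :+ con false :* (con false :* con true)))
            :+ con false :* (con false :* z) := x) refl x y (0# + (y * 1# + 0# * 0#))
        , solve 2 (λ x y → x :* (con false :+ (y :* con true :+ con false :* con false))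
            :+ con false :* (con true :+ (y :* con false :+ con false :* (con false :* con true)))
            := y :* x) refl x y )
        (Factors-* nilLinearity (Factors-embed f) (Factors-1+product nilLinearity
          {α = 0# , 1#} {β = y , 0#}
          (Linear-0# , F.1# , sym κ.1-homo) (lin , F.0# , sym κ.0-homo)
          (F.trans (F.+-cong ρ.0-homo (F.zeroˡ _)) (F.+-identityˡ F.0#))))

      -- A product of linear elements of R[θ] is C (1 + λ θ) or C (1 + λ θ) (θ + α), since
      -- units invert to linear elements and (θ + α)(θ + α′) = (θ + α)(α + α′).
      private
        data NormalForm : Q.Carrier → Set (c ⊔ ℓ) where
          one-unit : ∀ {x C lam} → Factors L C → Linear lam →
            x Q.≈ (C , C * lam) → NormalForm x
          non-unit : ∀ {x C lam α} → Factors L C → Linear lam → Linear α → ρ.⟪ α ⟫ F.≈ F.0# →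
            x Q.≈ (C * α , C * (1# + lam * α)) → NormalForm x

        -- The new factor is a (1 + μθ), and (1 + λθ)(1 + μθ) = 1 + (λ + μ)θ, so μ is absorbed into
        -- λ and a into C.
        multiple : ∀ {a b μ x y} → Linear a → Linear μ → b ≈ a * μ →
          x Q.≈ (a , b) Q.* y → NormalForm y → NormalForm x
        multiple {a} {b} {μ} lin-a lin-μ b≈aμ x≈ (one-unit {C = C} {lam} f lin y≈) =
          one-unit (mul lin-a f refl) (Linear-+ lin lin-μ)
            (Q.trans x≈ (Q.trans (Q.*-cong (refl , b≈aμ) y≈)
              ( solve 4 (λ a μ C lam → a :* C :+ con false :* ((a :* μ) :* (C :* lam)) := a :* C)
                  refl a μ C lam
              , solve 4 (λ a μ C lam → a :* (C :* lam) :+ (a :* μ) :* C := (a :* C) :* (lam :+ μ))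
                  refl a μ C lam )))
        multiple {a} {b} {μ} lin-a lin-μ b≈aμ x≈ (non-unit {C = C} {lam} {α} f lin lin-α α-nil y≈) =
          non-unit (mul lin-a f refl) (Linear-+ lin lin-μ) lin-α α-nil
            (Q.trans x≈ (Q.trans (Q.*-cong (refl , b≈aμ) y≈)
              ( solve 4 (λ a z C α → a :* (C :* α) :+ con false :* z := (a :* C) :* α)
                  refl a ((a * μ) * (C * (1# + lam * α))) C α
              , solve 5 (λ a μ C lam α →
                  a :* (C :* (con true :+ lam :* α)) :+ (a :* μ) :* (C :* α)
                  := (a :* C) :* (con true :+ (lam :+ μ) :* α)) refl a μ C lam α )))

        -- The new factor is e(θ + α). If the normal form already contains such a factor θ + α, the
        -- second, θ + α′, differs from it by α + α′; as (θ + α)² = 0, it can be replaced by α + α′,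
        -- which goes into C.
        monic : ∀ {a e α x y} → Linear α → ρ.⟪ α ⟫ F.≈ F.0# → a ≈ κ.⟪ e ⟫ * α →
          x Q.≈ (a , κ.⟪ e ⟫) Q.* y → NormalForm y → NormalForm x
        monic {a} {e} {α} lin-α α-nil a≈eα x≈ (one-unit {C = C} {lam} f lin y≈) =
          non-unit (mul (Linear-constant e) f refl) lin lin-α α-nil
            (Q.trans x≈ (Q.trans (Q.*-cong (a≈eα , refl) y≈)
              ( solve 4 (λ e α C z → (e :* α) :* C :+ con false :* z := (e :* C) :* α)
                  refl κ.⟪ e ⟫ α C (κ.⟪ e ⟫ * (C * lam))
              , solve 4 (λ e α C lam → (e :* α) :* (C :* lam) :+ e :* C := (e :* C) :* (con true :+ lam :* α))
                  refl κ.⟪ e ⟫ α C lam )))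
        monic {a} {e} {α′} lin-α′ α′-nil a≈eα′ x≈ (non-unit {C = C} {lam} {α} f lin lin-α α-nil y≈) =
          non-unit (mul (Linear-constant e) (mul (Linear-+ lin-α lin-α′) f refl) refl) lin lin-α α-nil
            (Q.trans x≈ (Q.trans (Q.*-cong (a≈eα′ , refl) y≈) (Q.sym
              ( trans (solve 5 (λ e α α′ C z → (e :* ((α :+ α′) :* C)) :* α
                    := ((e :* α′) :* (C :* α) :+ con false :* z) :+ (α :* α) :* (e :* C))
                  refl κ.⟪ e ⟫ α α′ C (κ.⟪ e ⟫ * (C * (1# + lam * α))))
                  (dropMultiple L α²≈0 _ _)
              , trans (solve 5 (λ e α α′ C lam → (e :* ((α :+ α′) :* C)) :* (con true :+ lam :* α)
                    := ((e :* α′) :* (C :* (con true :+ lam :* α)) :+ e :* (C :* α)) :+ (α :* α) :* (e :* C :* lam))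
                  refl κ.⟪ e ⟫ α α′ C lam)
                  (dropMultiple L α²≈0 _ _) ))))
          where α²≈0 = residue≈0⇒square≈0 α-nil

        scaleBack : ∀ {e i} x → e F.* i F.≈ F.1# → x ≈ κ.⟪ e ⟫ * (κ.⟪ i ⟫ * x)
        scaleBack {e} {i} x ei≈1 = sym (trans (sym (*-assoc _ _ _))
          (trans (*-congʳ (trans (sym (κ.*-homo e i)) (trans (κ.⟪⟫-cong ei≈1) κ.1-homo))) (*-identityˡ x)))

        -- From a² = ρ(a)² the inverse of a is a/ρ(a)², a constant multiple of a. So e/a is linear
        -- when a is.
        divideByUnit : ∀ {a i} e → ρ.⟪ a ⟫ F.* i F.≈ F.1# →
          a * (κ.⟪ e ⟫ * (κ.⟪ i F.* i ⟫ * a)) ≈ κ.⟪ e ⟫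
        divideByUnit {a} {i} e ri≈1 = begin
          a * (κ.⟪ e ⟫ * (κ.⟪ i F.* i ⟫ * a))
            ≈⟨ solve 3 (λ a e i → a :* (e :* (i :* a)) := e :* (i :* (a :* a))) refl a κ.⟪ e ⟫ κ.⟪ i F.* i ⟫ ⟩
          κ.⟪ e ⟫ * (κ.⟪ i F.* i ⟫ * (a * a))
            ≈⟨ *-congˡ (trans (*-congˡ (square a)) (sym (κ.*-homo _ _))) ⟩
          κ.⟪ e ⟫ * κ.⟪ (i F.* i) F.* (r F.* r) ⟫
            ≈⟨ *-congˡ (trans (κ.⟪⟫-cong (F.trans
                 (SF.solve 2 (λ i r → (i SF.:* i) SF.:* (r SF.:* r) SF.:= (r SF.:* i) SF.:* (r SF.:* i)) F.refl i r)
                 (F.trans (F.*-cong ri≈1 ri≈1) (F.*-identityˡ F.1#)))) κ.1-homo) ⟩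
          κ.⟪ e ⟫ * 1#
            ≈⟨ *-identityʳ _ ⟩
          κ.⟪ e ⟫ ∎
          where
          open Relation.Binary.Reasoning.Setoid setoid
          module SF = Char2Ring.Solver F two≈0
          r = ρ.⟪ a ⟫

        -- If a is a unit, a + eθ = a(1 + μθ) with μ = e/a. If a is nilpotent and e = 0, the same
        -- holds with μ = 0. If a is nilpotent and e ≠ 0, the factor is e(θ + a/e), and a/e again
        -- has residue 0.
        multiply : ∀ {a b e x y} → Dec (ρ.⟪ a ⟫ F.≈ F.0#) → Dec (e F.≈ F.0#) → Linear a → b ≈ κ.⟪ e ⟫ →
          x Q.≈ (a , b) Q.* y → NormalForm y → NormalForm x
        multiply {a} {b} {e} (no ρa≉0) _ lin b≈e x≈ nf =
          multiple lin (Linear-scale e (Linear-scale (i F.* i) lin))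
            (trans b≈e (sym (divideByUnit e (proj₂ (inverse _ ρa≉0))))) x≈ nf
          where i = proj₁ (inverse _ ρa≉0)
        multiply {a} {b} {e} (yes ρa≈0) (yes e≈0) lin b≈e x≈ nf = multiple lin Linear-0#
          (trans b≈e (trans (κ.⟪⟫-cong e≈0) (trans κ.0-homo (sym (zeroʳ a))))) x≈ nf
        multiply {a} {b} {e} (yes ρa≈0) (no e≉0) lin b≈e x≈ nf = monic {e = e} (Linear-scale i lin)
          (F.trans (ρ.*-homo _ _) (F.trans (F.*-congˡ ρa≈0) (F.zeroʳ _)))
          (scaleBack a (proj₂ (inverse e e≉0)))
          (Q.trans x≈ (Q.*-congʳ (refl , b≈e))) nf
          where i = proj₁ (inverse e e≉0)

        normalForm : ∀ {x} → Factors-Q x → NormalForm x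
        normalForm (unit p) = one-unit (unit refl) Linear-0# (Q.trans p (refl , sym (zeroʳ 1#)))
        normalForm (mul {y = a , b} (lin , e , b≈e) f p) =
          multiply (ρ.⟪ a ⟫ ≟F F.0#) (e ≟F F.0#) lin b≈e p (normalForm f)

      -- The coefficient of θ is Cλ in the first normal form. In the second it is C(1 + λα), where α
      -- has residue 0, so that `Factors-1+product` factors 1 + λα.
      Factors-coefficient : ∀ {x} → Factors-Q x → Factors L (proj₂ x)
      Factors-coefficient = split ∘ normalForm
        where
        split : ∀ {x} → NormalForm x → Factors L (proj₂ x)
        split (one-unit g lin (_ , q)) = Factors-resp L (sym q) (Factors-* L g (Factors-linear L lin))
        split (non-unit g lin lin-α α-nil (_ , q)) =
          Factors-resp L (sym q) (Factors-* L g (Factors-1+product L lin-α lin α-nil))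

    module _ {R : CommutativeRing c ℓ} (L : Linearity R) where
      private
        module R = CommutativeRing R
        module L = Linearity L
      open Grassmann R

      grassLinearity : ∀ n → Linearity (Grass n)
      grassLinearity zero = L
      grassLinearity (suc n) = nilLinearity {R = Grass n} (grassLinearity n)

      Factors-top : ∀ n {x} → Factors (grassLinearity n) x → Factors L (top n x)
      Factors-top zero f = f
      Factors-top (suc n) f = Factors-top n (Factors-coefficient {R = Grass n} (grassLinearity n) f)

      scalar-constant : ∀ n a → CommutativeRing._≈_ (Grass n)
        (Hom.⟪_⟫ (scalar n) L.κ.⟪ a ⟫) (Linearity.κ.⟪_⟫ (grassLinearity n) a)
      scalar-constant zero a = R.refl
      scalar-constant (suc n) a = scalar-constant n a , CommutativeRing.refl (Grass n)

      Linear-linearForm : ∀ n {d w} → L.Linear d → (∀ j → ∃ λ e → w j R.≈ L.κ.⟪ e ⟫) →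
        Linearity.Linear (grassLinearity n) (linearForm n d w)
      Linear-linearForm zero lin const = lin
      Linear-linearForm (suc n) lin const = Linear-linearForm n lin (const ∘ suc)
        , proj₁ (const zero)
        , CommutativeRing.trans (Grass n) (Hom.⟪⟫-cong (scalar n) (proj₂ (const zero))) (scalar-constant n _)

      -- In a linear element the weight of each θⱼ must be a constant, and Mᵢⱼ² is one, like every
      -- square. Only the diagonal entries occur unsquared, so linearity is asked of those alone.
      Factors-gaussian : ∀ n (M : Mat R n) → (∀ i → L.Linear (M i i)) →
        Factors (grassLinearity n) (gaussian n M)
      Factors-gaussian zero M lin = unit R.refl
      Factors-gaussian (suc n) M lin = Factors-pair {R = Grass n} (grassLinearity n)
        (Factors-gaussian n (λ i j → M (suc i) (suc j)) (lin ∘ suc))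
        (Linear-linearForm n (lin zero) (λ j → _ , L.square (M zero (suc j))))

-- Polynomial rings

module _ {c ℓ : Level} where

  module Convolution (R : CommutativeRing c ℓ) where
    open CommutativeRing R hiding (zero)
    private
      module S = Algebra.Solver.Ring.NaturalCoefficients.Default commutativeSemiring
      open S using (_:=_; _:+_; _:*_)

    convolve : (ℕ → Carrier) → (ℕ → Carrier) → ℕ → Carrier
    convolve f g zero = f 0 * g 0
    convolve f g (suc n) = f 0 * g (suc n) + convolve (f ∘ suc) g n

    convolve-cong : ∀ {f f′ g g′} → (∀ n → f n ≈ f′ n) → (∀ n → g n ≈ g′ n) →
      ∀ n → convolve f g n ≈ convolve f′ g′ n
    convolve-cong p q zero = *-cong (p 0) (q 0)
    convolve-cong p q (suc n) = +-cong (*-cong (p 0) (q (suc n))) (convolve-cong (p ∘ suc) q n)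

    -- The defining recursion splits off the first term, this one the last. Commutativity is the
    -- comparison of the two.
    convolve-sucʳ : ∀ f g n → convolve f g (suc n) ≈ convolve f (g ∘ suc) n + f (suc n) * g 0
    convolve-sucʳ f g zero = refl
    convolve-sucʳ f g (suc n) =
      trans (+-congˡ (convolve-sucʳ (f ∘ suc) g n)) (sym (+-assoc _ _ _))

    convolve-comm : ∀ f g n → convolve f g n ≈ convolve g f n
    convolve-comm f g zero = *-comm (f 0) (g 0)
    convolve-comm f g (suc n) = trans (+-cong (*-comm _ _) (convolve-comm (f ∘ suc) g n))
      (trans (+-comm _ _) (sym (convolve-sucʳ g f n)))

    convolve-zeroˡ : ∀ {f} → (∀ n → f n ≈ 0#) → ∀ g n → convolve f g n ≈ 0#
    convolve-zeroˡ p g zero = trans (*-congʳ (p 0)) (zeroˡ _)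
    convolve-zeroˡ p g (suc n) = trans
      (+-cong (trans (*-congʳ (p 0)) (zeroˡ _)) (convolve-zeroˡ (p ∘ suc) g n)) (+-identityˡ 0#)

    convolve-distribˡ : ∀ f g h n →
      convolve f (λ k → g k + h k) n ≈ convolve f g n + convolve f h n
    convolve-distribˡ f g h zero = distribˡ _ _ _
    convolve-distribˡ f g h (suc n) = trans (+-cong (distribˡ _ _ _) (convolve-distribˡ (f ∘ suc) g h n))
      (S.solve 4 (λ a b d e → (a :+ b) :+ (d :+ e) := (a :+ d) :+ (b :+ e)) refl _ _ _ _)

    convolve-distribʳ : ∀ f g h n →
      convolve (λ k → f k + g k) h n ≈ convolve f h n + convolve g h n
    convolve-distribʳ f g h n = trans (convolve-comm _ h n)
      (trans (convolve-distribˡ h f g n) (+-cong (convolve-comm h f n) (convolve-comm h g n)))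

    convolve-scaleˡ : ∀ a f g n → convolve (λ k → a * f k) g n ≈ a * convolve f g n
    convolve-scaleˡ a f g zero = *-assoc _ _ _
    convolve-scaleˡ a f g (suc n) =
      trans (+-cong (*-assoc _ _ _) (convolve-scaleˡ a (f ∘ suc) g n)) (sym (distribˡ _ _ _))

    convolve-assoc : ∀ f g h n → convolve (convolve f g) h n ≈ convolve f (convolve g h) n
    convolve-assoc f g h zero = *-assoc _ _ _
    convolve-assoc f g h (suc n) = trans
      (+-cong (*-assoc _ _ _) (trans
        (convolve-distribʳ (λ k → f 0 * g (suc k)) (convolve (f ∘ suc) g) h n)
        (+-cong (convolve-scaleˡ (f 0) (g ∘ suc) h n) (convolve-assoc (f ∘ suc) g h n))))
      (trans (sym (+-assoc _ _ _)) (+-congʳ (sym (distribˡ _ _ _))))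

  -- Polynomials are coefficient lists; lists differing by trailing zeros are equal.
  module _ (R : CommutativeRing c ℓ) where
    open CommutativeRing R hiding (zero)
    open Convolution R

    nth : List Carrier → ℕ → Carrier
    nth [] n = 0#
    nth (a ∷ p) zero = a
    nth (a ∷ p) (suc n) = nth p n

    -- A record and not the bare function type, so that p and q can be inferred from a proof of the
    -- relation.
    record _≃_ (p q : List Carrier) : Set ℓ where
      constructor coefficientwise
      field at : ∀ n → nth p n ≈ nth q n
    open _≃_

    _+ₚ_ : List Carrier → List Carrier → List Carrier
    [] +ₚ q = q
    (a ∷ p) +ₚ [] = a ∷ p
    (a ∷ p) +ₚ (b ∷ q) = (a + b) ∷ (p +ₚ q)

    _*ₚ_ : List Carrier → List Carrier → List Carrier
    [] *ₚ q = []
    (a ∷ p) *ₚ q = map (a *_) q +ₚ (0# ∷ (p *ₚ q))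

    nth-+ : ∀ p q n → nth (p +ₚ q) n ≈ nth p n + nth q n
    nth-+ [] q n = sym (+-identityˡ _)
    nth-+ (a ∷ p) [] n = sym (+-identityʳ _)
    nth-+ (a ∷ p) (b ∷ q) zero = refl
    nth-+ (a ∷ p) (b ∷ q) (suc n) = nth-+ p q n

    nth-map : ∀ (h : Carrier → Carrier) → h 0# ≈ 0# → ∀ p n → nth (map h p) n ≈ h (nth p n)
    nth-map h h0 [] n = sym h0
    nth-map h h0 (a ∷ p) zero = refl
    nth-map h h0 (a ∷ p) (suc n) = nth-map h h0 p n

    nth-* : ∀ p q n → nth (p *ₚ q) n ≈ convolve (nth p) (nth q) n
    nth-* [] q n = sym (convolve-zeroˡ (λ _ → refl) (nth q) n)
    nth-* (a ∷ p) q zero = trans (nth-+ (map (a *_) q) _ 0)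
      (trans (+-identityʳ _) (nth-map (a *_) (zeroʳ a) q 0))
    nth-* (a ∷ p) q (suc n) = trans (nth-+ (map (a *_) q) _ (suc n))
      (+-cong (nth-map (a *_) (zeroʳ a) q (suc n)) (nth-* p q n))

    private
      -‿zero : - 0# ≈ 0#
      -‿zero = trans (sym (+-identityʳ _)) (-‿inverseˡ 0#)

      nth-neg : ∀ p n → nth (map (-_) p) n ≈ - nth p n
      nth-neg = nth-map (-_) -‿zero

    Poly : CommutativeRing c ℓ
    Poly = mkCommutativeRing {_≈_ = _≃_}
      (record { refl = coefficientwise λ n → refl
              ; sym = λ e → coefficientwise λ n → sym (at e n)
              ; trans = λ e e′ → coefficientwise λ n → trans (at e n) (at e′ n) })
      _+ₚ_ _*ₚ_ (map (-_)) [] (1# ∷ [])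
      (λ {p} {p′} {q} {q′} e e′ → coefficientwise λ n →
        trans (nth-+ p q n) (trans (+-cong (at e n) (at e′ n)) (sym (nth-+ p′ q′ n))))
      (λ p q r → coefficientwise λ n → trans (trans (nth-+ (p +ₚ q) r n) (+-congʳ (nth-+ p q n)))
        (trans (+-assoc _ _ _) (sym (trans (nth-+ p (q +ₚ r) n) (+-congˡ (nth-+ q r n))))))
      (λ p q → coefficientwise λ n → trans (nth-+ p q n) (trans (+-comm _ _) (sym (nth-+ q p n))))
      (λ p → coefficientwise λ n → refl)
      (λ {p} {q} e → coefficientwise λ n →
        trans (nth-neg p n) (trans (-‿cong (at e n)) (sym (nth-neg q n))))
      (λ p → coefficientwise λ n →
        trans (nth-+ (map (-_) p) p n) (trans (+-congʳ (nth-neg p n)) (-‿inverseˡ _)))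
      (λ {p} {p′} {q} {q′} e e′ → coefficientwise λ n →
        trans (nth-* p q n) (trans (convolve-cong (at e) (at e′) n) (sym (nth-* p′ q′ n))))
      (λ p q r → coefficientwise λ n → trans
        (trans (nth-* (p *ₚ q) r n) (convolve-cong (nth-* p q) (λ _ → refl) n))
        (trans (convolve-assoc (nth p) (nth q) (nth r) n)
          (sym (trans (nth-* p (q *ₚ r) n) (convolve-cong (λ _ → refl) (nth-* q r) n)))))
      (λ p q → coefficientwise λ n →
        trans (nth-* p q n) (trans (convolve-comm (nth p) (nth q) n) (sym (nth-* q p n))))
      (λ p → coefficientwise λ n → trans (nth-* (1# ∷ []) p n) (convolve-oneˡ (nth p) n))
      (λ p q r → coefficientwise λ n → trans
        (trans (nth-* p (q +ₚ r) n) (convolve-cong (λ _ → refl) (nth-+ q r) n))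
        (trans (convolve-distribˡ (nth p) (nth q) (nth r) n)
          (sym (trans (nth-+ (p *ₚ q) (p *ₚ r) n) (+-cong (nth-* p q n) (nth-* p r n))))))
      where
      convolve-oneˡ : ∀ g n → convolve (nth (1# ∷ [])) g n ≈ g n
      convolve-oneˡ g zero = *-identityˡ _
      convolve-oneˡ g (suc n) = trans
        (+-cong (*-identityˡ _) (convolve-zeroˡ (λ _ → refl) g n)) (+-identityʳ _)

    constantPoly : Hom R Poly
    constantPoly = record
      { ⟪_⟫ = λ a → a ∷ []
      ; ⟪⟫-cong = λ p → coefficientwise λ { zero → p ; (suc n) → refl }
      ; +-homo = λ a b → coefficientwise λ n → refl
      ; *-homo = λ a b → coefficientwise λ { zero → sym (+-identityʳ _) ; (suc n) → refl }
      ; 1-homo = coefficientwise λ n → refl }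

    X : List Carrier
    X = 0# ∷ 1# ∷ []

    module _ {S : CommutativeRing c ℓ} (φ : Hom R S) (x : CommutativeRing.Carrier S) where
      private
        module S = CommutativeRing S
        module φ = Hom φ
        module N = Algebra.Solver.Ring.NaturalCoefficients.Default S.commutativeSemiring

      horner : List Carrier → S.Carrier
      horner [] = S.0#
      horner (a ∷ p) = φ.⟪ a ⟫ S.+ x S.* horner p

      private
        horner-step : ∀ {a p} → a ≈ 0# → horner p S.≈ S.0# → horner (a ∷ p) S.≈ S.0#
        horner-step a≈0 p≈0 = S.trans
          (S.+-cong (S.trans (φ.⟪⟫-cong a≈0) φ.0-homo) (S.trans (S.*-congˡ p≈0) (S.zeroʳ x)))
          (S.+-identityˡ S.0#)

        horner-zero : ∀ p → (∀ n → nth p n ≈ 0#) → horner p S.≈ S.0#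
        horner-zero [] e = S.refl
        horner-zero (a ∷ p) e = horner-step {a} {p} (e 0) (horner-zero p (e ∘ suc))

        horner-cong : ∀ p q → (∀ n → nth p n ≈ nth q n) → horner p S.≈ horner q
        horner-cong [] q e = S.sym (horner-zero q (λ n → sym (e n)))
        horner-cong (a ∷ p) [] e = horner-zero (a ∷ p) e
        horner-cong (a ∷ p) (b ∷ q) e =
          S.+-cong (φ.⟪⟫-cong (e 0)) (S.*-congˡ (horner-cong p q (e ∘ suc)))

        horner-+ : ∀ p q → horner (p +ₚ q) S.≈ horner p S.+ horner q
        horner-+ [] q = S.sym (S.+-identityˡ _)
        horner-+ (a ∷ p) [] = S.sym (S.+-identityʳ _)
        horner-+ (a ∷ p) (b ∷ q) = S.trans
          (S.+-cong (φ.+-homo a b) (S.*-congˡ (horner-+ p q)))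
          (N.solve 5 (λ a b p q x → (a N.:+ b) N.:+ x N.:* (p N.:+ q)
              N.:= (a N.:+ x N.:* p) N.:+ (b N.:+ x N.:* q)) S.refl
            φ.⟪ a ⟫ φ.⟪ b ⟫ (horner p) (horner q) x)

        horner-scale : ∀ a q → horner (map (a *_) q) S.≈ φ.⟪ a ⟫ S.* horner q
        horner-scale a [] = S.sym (S.zeroʳ _)
        horner-scale a (b ∷ q) = S.trans
          (S.+-cong (φ.*-homo a b) (S.*-congˡ (horner-scale a q)))
          (N.solve 4 (λ a b q x → a N.:* b N.:+ x N.:* (a N.:* q) N.:= a N.:* (b N.:+ x N.:* q)) S.refl
            φ.⟪ a ⟫ φ.⟪ b ⟫ (horner q) x)

        horner-* : ∀ p q → horner (p *ₚ q) S.≈ horner p S.* horner q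
        horner-* [] q = S.sym (S.zeroˡ _)
        horner-* (a ∷ p) q = S.trans (horner-+ (map (a *_) q) (0# ∷ (p *ₚ q)))
          (S.trans (S.+-cong (horner-scale a q)
              (S.trans (S.+-cong φ.0-homo (S.*-congˡ (horner-* p q))) (S.+-identityˡ _)))
            (N.solve 4 (λ a p q x → a N.:* q N.:+ x N.:* (p N.:* q) N.:= (a N.:+ x N.:* p) N.:* q) S.refl
              φ.⟪ a ⟫ (horner p) (horner q) x))

      evalPoly : Hom Poly S
      evalPoly = record
        { ⟪_⟫ = horner
        ; ⟪⟫-cong = λ {p} {q} e → horner-cong p q (at e)
        ; +-homo = horner-+
        ; *-homo = horner-*
        ; 1-homo = S.trans (S.+-cong φ.1-homo (S.zeroʳ x)) (S.+-identityʳ S.1#) }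

  module Multivariate (F : CommutativeRing c ℓ) where
    open CommutativeRing F hiding (zero)
    Pol : ℕ → CommutativeRing c ℓ
    Pol zero = F
    Pol (suc m) = Poly (Pol m)

    private module P (m : ℕ) = CommutativeRing (Pol m)

    constantPol : ∀ m → Hom F (Pol m)
    constantPol zero = idHom {R = F}
    constantPol (suc m) = _∘ʰ_ {R = F} {S = Pol m} {T = Poly (Pol m)} (constantPoly (Pol m)) (constantPol m)

    variablePol : ∀ {m} → Fin m → P.Carrier m
    variablePol {suc m} zero = X (Pol m)
    variablePol {suc m} (suc i) = variablePol i ∷ []

    coefficient : ∀ m → P.Carrier m → Mono F m → Carrier
    coefficient zero f [] = f
    coefficient (suc m) f (k ∷ α) = coefficient m (nth (Pol m) f k) α

    coefficient-cong : ∀ m {f g} → P._≈_ m f g → ∀ α → coefficient m f α ≈ coefficient m g α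
    coefficient-cong zero e [] = e
    coefficient-cong (suc m) e (k ∷ α) = coefficient-cong m (_≃_.at e k) α

    coefficient-injective : ∀ m {f g} → (∀ α → coefficient m f α ≈ coefficient m g α) → P._≈_ m f g
    coefficient-injective zero e = e []
    coefficient-injective (suc m) e = coefficientwise λ k → coefficient-injective m (λ α → e (k ∷ α))

    coefficient-+ : ∀ m f g α →
      coefficient m (P._+_ m f g) α ≈ coefficient m f α + coefficient m g α
    coefficient-+ zero f g [] = refl
    coefficient-+ (suc m) f g (k ∷ α) =
      trans (coefficient-cong m (nth-+ (Pol m) f g k) α) (coefficient-+ m _ _ α)

    coefficient-0# : ∀ m α → coefficient m (P.0# m) α ≈ 0#
    coefficient-0# zero [] = refl
    coefficient-0# (suc m) (k ∷ α) = coefficient-0# m α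

    convL : ∀ {m} → (Mono F m → Carrier) → (Mono F m → Carrier) → Mono F m → Carrier
    convL p q α = sumR F (map (λ β → p β * q (monus F α β)) (below F α))

    sumR-++ : ∀ xs ys → sumR F (xs ++ ys) ≈ sumR F xs + sumR F ys
    sumR-++ [] ys = sym (+-identityˡ _)
    sumR-++ (x ∷ xs) ys = trans (+-congˡ (sumR-++ xs ys)) (sym (+-assoc _ _ _))

    sumR-concatMap : ∀ {A B : Set} (h : B → Carrier) (g : A → List B) xs →
      sumR F (map h (concatMap g xs)) ≈ sumR F (map (λ x → sumR F (map h (g x))) xs)
    sumR-concatMap h g [] = refl
    sumR-concatMap h g (x ∷ xs) = trans (reflexive (≡.cong (sumR F) (map-++ h (g x) (concatMap g xs))))
      (trans (sumR-++ (map h (g x)) _) (+-congˡ (sumR-concatMap h g xs)))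

    sumR-map-cong : ∀ {A : Set} {h k : A → Carrier} xs → (∀ x → h x ≈ k x) →
      sumR F (map h xs) ≈ sumR F (map k xs)
    sumR-map-cong [] e = refl
    sumR-map-cong (x ∷ xs) e = +-cong (e x) (sumR-map-cong xs e)

    -- `below` lists the monomials by their first exponent j. Grouping by j turns the convolution
    -- into a one-variable convolution whose terms are convolutions in m variables, which is how
    -- multiplication works in `Poly (Pol m)`.
    convL-∷ : ∀ {m} (p q : Mono F (suc m) → Carrier) k α → convL p q (k ∷ α)
      ≈ sumR F (applyUpTo (λ j → convL (p ∘ (j ∷_)) (q ∘ ((k ∸ j) ∷_)) α) (suc k))
    convL-∷ p q k α = trans
      (sumR-concatMap (λ β → p β * q (monus F (k ∷ α) β)) (λ j → map (j ∷_) (below F α)) (applyUpTo id (suc k)))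
      (trans
        (sumR-map-cong (applyUpTo id (suc k))
          (λ j → reflexive (≡.cong (sumR F) (≡.sym (map-∘ (below F α))))))
        (reflexive (≡.cong (sumR F) (map-applyUpTo id _ (suc k)))))

    coefficient-* : ∀ m f g α → coefficient m (P._*_ m f g) α ≈ convL (coefficient m f) (coefficient m g) α
    coefficient-convolve : ∀ m u v k α → coefficient m (Convolution.convolve (Pol m) u v k) α
      ≈ sumR F (applyUpTo (λ j → convL (coefficient m (u j)) (coefficient m (v (k ∸ j))) α) (suc k))

    coefficient-convolve m u v zero α = trans (coefficient-* m (u 0) (v 0) α) (sym (+-identityʳ _))
    coefficient-convolve m u v (suc k) α = trans (coefficient-+ m _ _ α)
      (+-cong (coefficient-* m (u 0) (v (suc k)) α) (coefficient-convolve m (u ∘ suc) v k α))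

    coefficient-* zero f g [] = sym (+-identityʳ _)
    coefficient-* (suc m) f g (k ∷ α) = trans (coefficient-cong m (nth-* (Pol m) f g k) α)
      (trans (coefficient-convolve m (nth (Pol m) f) (nth (Pol m) g) k α)
        (sym (convL-∷ (coefficient (suc m) f) (coefficient (suc m) g) k α)))

-- The quotient rings R(ℓ²)

module _ {c ℓ : Level} where

  module Product (R : CommutativeRing c ℓ) where
    open Algebra.Properties.CommutativeMonoid.Sum (CommutativeRing.*-commutativeMonoid R) public
      using () renaming (sum to product; sum-cong-≋ to product-cong)

  module Evaluation (F : CommutativeRing c ℓ) where
    private module F = CommutativeRing F

    module _ (S : CommutativeRing c ℓ) (κ : Hom F S) {m : ℕ} (x : Fin m → CommutativeRing.Carrier S) where
      open CommutativeRing S hiding (zero)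
      open Sum S
      open Product S
      open Determinant S

      eval : Expr F m → Carrier
      eval (con a) = Hom.⟪_⟫ κ a
      eval (var i) = x i
      eval (P ⊕ Q) = eval P + eval Q
      eval (P ⊗ Q) = eval P * eval Q
      eval (neg P) = - eval P

      eval-ΣE : ∀ {n} (f : Fin n → Expr F m) → eval (ΣE F f) ≈ sum (eval ∘ f)
      eval-ΣE {zero} f = Hom.0-homo κ
      eval-ΣE {suc n} f = +-congˡ (eval-ΣE (f ∘ suc))

      eval-ΠE : ∀ {n} (f : Fin n → Expr F m) → eval (ΠE F f) ≈ product (eval ∘ f)
      eval-ΠE {zero} f = Hom.1-homo κ
      eval-ΠE {suc n} f = *-congˡ (eval-ΠE (f ∘ suc))

      module _ (two≈0 : Char2 F) where
        open Char2Ring S (Hom.homo-char2 κ two≈0) using (-x≈x)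

        eval-sign : ∀ k P → eval (sign F k P) ≈ eval P
        eval-sign zero P = refl
        eval-sign (suc k) P = trans (-x≈x _) (eval-sign k P)

        eval-det : ∀ {n} (M : Fin n → Fin n → Expr F m) →
          eval (det F M) ≈ unsignedDet (λ i j → eval (M i j))
        eval-det {zero} M = Hom.1-homo κ
        eval-det {suc n} M = trans
          (eval-ΣE (λ j → sign F (toℕ j) (M zero j ⊗ det F (λ r s → M (suc r) (punchIn j s)))))
          (sum-cong-≋ λ j → trans (eval-sign (toℕ j) (M zero j ⊗ det F (λ r s → M (suc r) (punchIn j s))))
            (*-congˡ {eval (M zero j)} (eval-det (λ r s → M (suc r) (punchIn j s)))))

    eval-natural : ∀ (S T : CommutativeRing c ℓ) (φ : Hom S T) (κ : Hom F S) (κ′ : Hom F T) {m}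
      (x : Fin m → CommutativeRing.Carrier S) (x′ : Fin m → CommutativeRing.Carrier T) →
      let open CommutativeRing T in
      (∀ a → Hom.⟪_⟫ φ (Hom.⟪_⟫ κ a) ≈ Hom.⟪_⟫ κ′ a) → (∀ i → Hom.⟪_⟫ φ (x i) ≈ x′ i) →
      ∀ P → Hom.⟪_⟫ φ (eval S κ x P) ≈ eval T κ′ x′ P
    eval-natural S T φ κ κ′ x x′ con≈ var≈ = go
      where
      open CommutativeRing T
      go : ∀ P → Hom.⟪_⟫ φ (eval S κ x P) ≈ eval T κ′ x′ P
      go (con a) = con≈ a
      go (var i) = var≈ i
      go (P ⊕ Q) = trans (Hom.+-homo φ _ _) (+-cong (go P) (go Q))
      go (P ⊗ Q) = trans (Hom.*-homo φ _ _) (*-cong (go P) (go Q))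
      go (neg P) = trans (Hom.-‿homo φ _) (-‿cong (go P))

    open Multivariate F
    private module P (m : ℕ) = CommutativeRing (Pol m)

    polynomial : ∀ {m} → Expr F m → P.Carrier m
    polynomial {m} = eval (Pol m) (constantPol m) variablePol

    coefficient-constantPol : ∀ m a α → coefficient m (Hom.⟪_⟫ (constantPol m) a) α F.≈ isZeroMono F α a
    coefficient-constantPol zero a [] = F.refl
    coefficient-constantPol (suc m) a (zero ∷ α) = coefficient-constantPol m a α
    coefficient-constantPol (suc m) a (suc k ∷ α) = coefficient-0# m α

    coefficient-variablePol : ∀ {m} (i : Fin m) α → coefficient m (variablePol i) α F.≈ isUnitMono F i α
    coefficient-variablePol {suc m} zero (zero ∷ α) = coefficient-0# m α
    coefficient-variablePol {suc m} zero (1 ∷ α) = F.trans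
      (coefficient-cong m (P.sym m (Hom.1-homo (constantPol m))) α) (coefficient-constantPol m F.1# α)
    coefficient-variablePol {suc m} zero (suc (suc k) ∷ α) = coefficient-0# m α
    coefficient-variablePol {suc m} (suc i) (zero ∷ α) = coefficient-variablePol i α
    coefficient-variablePol {suc m} (suc i) (suc k ∷ α) = coefficient-0# m α

    coefficient-neg : ∀ m f α → coefficient m (P.-_ m f) α F.≈ F.- coefficient m f α
    coefficient-neg m f α = F.trans (F.sym (F.+-identityʳ _))
      (F.trans (F.+-congˡ (F.sym (F.-‿inverseʳ _))) (F.trans (F.sym (F.+-assoc _ _ _))
        (F.trans (F.+-congʳ (F.trans (F.sym (coefficient-+ m (P.-_ m f) f α))
            (F.trans (coefficient-cong m (P.-‿inverseˡ m f) α) (coefficient-0# m α))))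
          (F.+-identityˡ _))))

    -- The bridge from the coefficients of expressions, in which the theorem is stated, to `Pol`,
    -- where the laws of a commutative ring are available.
    coefficient-polynomial : ∀ {m} (Q : Expr F m) α → coefficient m (polynomial Q) α F.≈ coeff F Q α
    coefficient-polynomial {m} (con a) α = coefficient-constantPol m a α
    coefficient-polynomial (var i) α = coefficient-variablePol i α
    coefficient-polynomial {m} (P ⊕ Q) α = F.trans (coefficient-+ m _ _ α)
      (F.+-cong (coefficient-polynomial P α) (coefficient-polynomial Q α))
    coefficient-polynomial {m} (P ⊗ Q) α = F.trans (coefficient-* m (polynomial P) (polynomial Q) α)
      (sumR-map-cong (below F α) (λ β →
        F.*-cong (coefficient-polynomial P β) (coefficient-polynomial Q (monus F α β))))
    coefficient-polynomial {m} (neg P) α =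
      F.trans (coefficient-neg m _ α) (F.-‿cong (coefficient-polynomial P α))

    ≋⇒polynomial≈ : ∀ {m} {P Q : Expr F m} → _≋_ F P Q → P._≈_ m (polynomial P) (polynomial Q)
    ≋⇒polynomial≈ {m} {P} {Q} e = coefficient-injective m λ α → F.trans (coefficient-polynomial P α)
      (F.trans (e α) (F.sym (coefficient-polynomial Q α)))

    polynomial≈⇒≋ : ∀ {m} {P Q : Expr F m} → P._≈_ m (polynomial P) (polynomial Q) → _≋_ F P Q
    polynomial≈⇒≋ {m} {P} {Q} e α = F.trans (F.sym (coefficient-polynomial P α))
      (F.trans (coefficient-cong m e α) (coefficient-polynomial Q α))

    -- R(ℓ²) = F[x₁,…,xₘ]/(xᵢ² + ℓᵢ²), built by adjoining one square root at a time.
    Residue : ∀ m → (Fin m → F.Carrier) → CommutativeRing c ℓ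
    constantRes : ∀ m l → Hom F (Residue m l)

    Residue zero l = F
    Residue (suc m) l = Quad (Residue m (l ∘ suc)) (Hom.⟪_⟫ (constantRes m (l ∘ suc)) (squares F l zero))

    constantRes zero l = idHom {R = F}
    constantRes (suc m) l = _∘ʰ_ {R = F} {S = Residue m (l ∘ suc)} {T = Residue (suc m) l}
      (embed (Residue m (l ∘ suc)) (Hom.⟪_⟫ (constantRes m (l ∘ suc)) (squares F l zero)))
      (constantRes m (l ∘ suc))

    embedRes : ∀ m l → Hom (Residue m (l ∘ suc)) (Residue (suc m) l)
    embedRes m l = embed (Residue m (l ∘ suc)) (Hom.⟪_⟫ (constantRes m (l ∘ suc)) (squares F l zero))

    variableRes : ∀ m l → Fin m → CommutativeRing.Carrier (Residue m l)
    variableRes (suc m) l zero = CommutativeRing.0# (Residue m (l ∘ suc)) , CommutativeRing.1# (Residue m (l ∘ suc))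
    variableRes (suc m) l (suc i) = variableRes m (l ∘ suc) i , CommutativeRing.0# (Residue m (l ∘ suc))

    residue : ∀ {m} l → Expr F m → CommutativeRing.Carrier (Residue m l)
    residue {m} l = eval (Residue m l) (constantRes m l) (variableRes m l)

    project : ∀ m l → Hom (Pol m) (Residue m l)
    project zero l = idHom {R = F}
    project (suc m) l = evalPoly (Pol m) {S = Residue (suc m) l}
      (_∘ʰ_ {R = Pol m} {S = Residue m (l ∘ suc)} {T = Residue (suc m) l} (embedRes m l) (project m (l ∘ suc)))
      (variableRes (suc m) l zero)

    private
      module Res {m : ℕ} (l : Fin m → F.Carrier) = CommutativeRing (Residue m l)

      module Step {m : ℕ} (l : Fin (suc m) → F.Carrier) where
        open CommutativeRing (Residue m (l ∘ suc)) hiding (zero)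
        module S = Algebra.Solver.Ring.NaturalCoefficients.Default commutativeSemiring
        open S
        s = Hom.⟪_⟫ (constantRes m (l ∘ suc)) (squares F l zero)
        module π = Hom (project m (l ∘ suc))

        horner-one : ∀ a → Res._≈_ l (Hom.⟪_⟫ (project (suc m) l) (a ∷ [])) (π.⟪ a ⟫ , 0#)
        horner-one a =
            S.solve 2 (λ a s → a :+ (con 0 :* con 0 :+ s :* (con 1 :* con 0)) := a) refl π.⟪ a ⟫ s
          , S.solve 0 (con 0 :+ (con 0 :* con 0 :+ con 1 :* con 0) := con 0) refl

        horner-two : ∀ a b → Res._≈_ l (Hom.⟪_⟫ (project (suc m) l) (a ∷ b ∷ [])) (π.⟪ a ⟫ , π.⟪ b ⟫)
        horner-two a b =
            S.solve 3 (λ a b s →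
              a :+ (con 0 :* (b :+ (con 0 :* con 0 :+ s :* (con 1 :* con 0)))
                :+ s :* (con 1 :* (con 0 :+ (con 0 :* con 0 :+ con 1 :* con 0))))
              := a) refl π.⟪ a ⟫ π.⟪ b ⟫ s
          , S.solve 2 (λ b s →
              con 0 :+ (con 0 :* (con 0 :+ (con 0 :* con 0 :+ con 1 :* con 0))
                :+ con 1 :* (b :+ (con 0 :* con 0 :+ s :* (con 1 :* con 0))))
              := b) refl π.⟪ b ⟫ s

    project-constant : ∀ m l a →
      Res._≈_ l (Hom.⟪_⟫ (project m l) (Hom.⟪_⟫ (constantPol m) a)) (Hom.⟪_⟫ (constantRes m l) a)
    project-constant zero l a = F.refl
    project-constant (suc m) l a = Res.trans l (Step.horner-one l _)
      (project-constant m (l ∘ suc) a , Res.refl (l ∘ suc))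

    project-variable : ∀ m l i →
      Res._≈_ l (Hom.⟪_⟫ (project m l) (variablePol i)) (variableRes m l i)
    project-variable (suc m) l zero = Res.trans l (Step.horner-two l _ _)
      (Hom.0-homo (project m (l ∘ suc)) , Hom.1-homo (project m (l ∘ suc)))
    project-variable (suc m) l (suc i) = Res.trans l (Step.horner-one l _)
      (project-variable m (l ∘ suc) i , Res.refl (l ∘ suc))

    project-polynomial : ∀ {m} l (P : Expr F m) →
      Res._≈_ l (Hom.⟪_⟫ (project m l) (polynomial P)) (residue l P)
    project-polynomial {m} l = eval-natural (Pol m) (Residue m l) (project m l)
      (constantPol m) (constantRes m l) variablePol (variableRes m l) (project-constant m l) (project-variable m l)

    variableRes-square : ∀ m l i → Res._≈_ l (Res._*_ l (variableRes m l i) (variableRes m l i))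
      (Hom.⟪_⟫ (constantRes m l) (squares F l i))
    variableRes-square (suc m) l zero =
        S.solve 1 (λ s → con 0 :* con 0 :+ s :* (con 1 :* con 1) := s) refl s
      , S.solve 0 (con 0 :* con 1 :+ con 1 :* con 0 := con 0) refl
      where
      open CommutativeRing (Residue m (l ∘ suc)) hiding (zero)
      open Step l using (s; module S)
      open S
    variableRes-square (suc m) l (suc i) =
        trans (S.solve 2 (λ a s → a :* a :+ s :* (con 0 :* con 0) := a :* a) refl (variableRes m (l ∘ suc) i) s)
          (variableRes-square m (l ∘ suc) i)
      , S.solve 1 (λ a → a :* con 0 :+ con 0 :* a := con 0) refl (variableRes m (l ∘ suc) i)
      where
      open CommutativeRing (Residue m (l ∘ suc)) hiding (zero)
      open Step l using (s; module S)
      open S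

    -- In its first variable a multilinear polynomial is a + b x₀, and `Quad` stores just such
    -- pairs. No reduction by x₀² = ℓ₀² takes place, and the projection of f reads off those of a
    -- and b.
    project-injective : ∀ m l f →
      (∀ α i → 2 ℕ.≤ lookup α i → coefficient m f α F.≈ F.0#) →
      Res._≈_ l (Hom.⟪_⟫ (project m l) f) (Res.0# l) → ∀ α → coefficient m f α F.≈ F.0#
    project-injective zero l f mult e [] = e
    project-injective (suc m) l f mult e = vanish
      where
      open _≃_
      open P m using (refl)
      a = nth (Pol m) f 0
      b = nth (Pol m) f 1
      truncate : _≃_ (Pol m) f (a ∷ b ∷ [])
      truncate = coefficientwise λ
        { zero → refl
        ; (suc zero) → refl
        ; (suc (suc k)) → coefficient-injective m λ α →
            F.trans (mult (suc (suc k) ∷ α) zero (s≤s (s≤s z≤n))) (F.sym (coefficient-0# m α)) }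
      parts : Res._≈_ l (Hom.⟪_⟫ (project m (l ∘ suc)) a , Hom.⟪_⟫ (project m (l ∘ suc)) b) (Res.0# l)
      parts = Res.trans l (Res.sym l (Step.horner-two l a b))
        (Res.trans l (Hom.⟪⟫-cong (project (suc m) l) {a ∷ b ∷ []} {f} (P.sym (suc m) {f} {a ∷ b ∷ []} truncate)) e)
      vanish : ∀ α → coefficient (suc m) f α F.≈ F.0#
      vanish (zero ∷ α) =
        project-injective m (l ∘ suc) a (λ α i → mult (zero ∷ α) (suc i)) (proj₁ parts) α
      vanish (1 ∷ α) =
        project-injective m (l ∘ suc) b (λ α i → mult (1 ∷ α) (suc i)) (proj₂ parts) α
      vanish (suc (suc k) ∷ α) = mult (suc (suc k) ∷ α) zero (s≤s (s≤s z≤n))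

-- The ideal I(ℓ²)

module _ {c ℓ : Level} where

  module Ideal (F : CommutativeRing c ℓ) (two≈0 : Char2 F) where
    open Evaluation F
    open Multivariate F
    private
      module F = CommutativeRing F
      module P (m : ℕ) = CommutativeRing (Pol m)
      module C (m : ℕ) = Hom (constantPol m)

    generator : ∀ {m} → (Fin m → F.Carrier) → Fin m → Expr F m
    generator lam i = (var i ⊗ var i) ⊕ con (lam i)

    module _ {m : ℕ} where
      open CommutativeRing (Pol m) hiding (zero)
      open Sum (Pol m)
      open Char2Ring (Pol m) (C.homo-char2 m two≈0)
      open Solver

      combination : (Fin m → F.Carrier) → (Fin m → Expr F m) → Carrier
      combination lam h = sum (λ i → polynomial (h i) * polynomial (generator lam i))

      -- The multipliers are expressions, as `InIdeal` demands, whereas f is an element of the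
      -- polynomial ring and can be rewritten by ring identities.
      record Generated (lam : Fin m → F.Carrier) (f : Carrier) : Set (c ⊔ ℓ) where
        constructor _,_
        field
          multipliers : Fin m → Expr F m
          expansion   : f ≈ combination lam multipliers

      record Congruent (lam : Fin m → F.Carrier) (f g : Carrier) : Set (c ⊔ ℓ) where
        constructor congruent
        field generated : Generated lam (f + g)

      module _ {lam : Fin m → F.Carrier} where

        Generated⇒InIdeal : ∀ {P} → Generated lam (polynomial P) → InIdeal F lam P
        Generated⇒InIdeal {P} (h , e) = h , polynomial≈⇒≋ {P = P} {Q = ΣE F (λ i → h i ⊗ generator lam i)}
          (trans e (sym (eval-ΣE (Pol m) (constantPol m) variablePol (λ i → h i ⊗ generator lam i))))

        Generated-resp : ∀ {f g} → f ≈ g → Generated lam f → Generated lam g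
        Generated-resp f≈g (h , e) = h , trans (sym f≈g) e

        Generated-+ : ∀ {f g} → Generated lam f → Generated lam g → Generated lam (f + g)
        Generated-+ (h , e) (h′ , e′) = (λ i → h i ⊕ h′ i) , trans (+-cong e e′)
          (trans (sym (∑-distrib-+ (λ i → polynomial (h i) * polynomial (generator lam i)) _))
            (sum-cong-≋ λ i → sym (distribʳ _ (polynomial (h i)) (polynomial (h′ i)))))

        Generated-* : ∀ Q {f} → Generated lam f → Generated lam (polynomial Q * f)
        Generated-* Q (h , e) = (λ i → Q ⊗ h i) , trans (*-congˡ e)
          (trans (*-distribˡ-sum (polynomial Q) (λ i → polynomial (h i) * polynomial (generator lam i)))
            (sum-cong-≋ λ i → sym (*-assoc (polynomial Q) (polynomial (h i)) _)))

        Generated-0# : ∀ {f} → f ≈ 0# → Generated lam f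
        Generated-0# {f} f≈0 = (λ _ → con F.0#) , trans f≈0
          (sym (sum-zero (λ i → polynomial (con {m = m} F.0#) * polynomial (generator lam i))
            (λ i → trans (*-congʳ (C.0-homo m)) (zeroˡ _))))

        ≈⇒∼ : ∀ {f g} → f ≈ g → Congruent lam f g
        ≈⇒∼ {f} {g} f≈g = congruent (Generated-0# (trans (+-congʳ f≈g) (x+x≈0 g)))

        ∼-respʳ : ∀ {f g h} → g ≈ h → Congruent lam f g → Congruent lam f h
        ∼-respʳ g≈h (congruent p) = congruent (Generated-resp (+-congˡ g≈h) p)

        ∼-sym : ∀ {f g} → Congruent lam f g → Congruent lam g f
        ∼-sym {f} {g} (congruent p) = congruent (Generated-resp (+-comm f g) p)

        ∼-trans : ∀ {f g h} → Congruent lam f g → Congruent lam g h → Congruent lam f h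
        ∼-trans {f} {g} {h} (congruent p) (congruent q) = congruent (Generated-resp
          (solve 3 (λ f g h → (f :+ g) :+ (g :+ h) := f :+ h) refl f g h) (Generated-+ p q))

        ∼-+ : ∀ {f f′ g g′} → Congruent lam f g → Congruent lam f′ g′ → Congruent lam (f + f′) (g + g′)
        ∼-+ {f} {f′} {g} {g′} (congruent p) (congruent q) = congruent (Generated-resp
          (solve 4 (λ f f′ g g′ → (f :+ g) :+ (f′ :+ g′) := (f :+ f′) :+ (g :+ g′)) refl f f′ g g′)
          (Generated-+ p q))

        ∼-neg : ∀ {f g} → Congruent lam f g → Congruent lam (- f) (- g)
        ∼-neg {f} {g} (congruent p) = congruent (Generated-resp (sym (+-cong (-x≈x f) (-x≈x g))) p)

        -- By f f′ + g g′ = f (f′ + g′) + g′ (f + g). The multipliers f and g′ have to come from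
        -- expressions because those of `Generated` do; hence the mixed form of the statement.
        ∼-* : ∀ Q Q′ {f′ g} → Congruent lam (polynomial Q) g → Congruent lam f′ (polynomial Q′) →
          Congruent lam (polynomial Q * f′) (g * polynomial Q′)
        ∼-* Q Q′ {f′} {g} (congruent p) (congruent q) = congruent (Generated-resp
          (solve 4 (λ f f′ g g′ → f :* (f′ :+ g′) :+ g′ :* (f :+ g) := f :* f′ :+ g :* g′) refl
            (polynomial Q) f′ g (polynomial Q′))
          (Generated-+ (Generated-* Q q) (Generated-* Q′ p)))

    module _ {m : ℕ} where
      private
        module P₀ = CommutativeRing (Pol m)
        module K = Hom (constantPoly (Pol m))
      open CommutativeRing (Pol (suc m)) hiding (zero)
      open Char2Ring (Pol (suc m)) (C.homo-char2 (suc m) two≈0)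
      open Solver
      open _≃_

      weaken : Expr F m → Expr F (suc m)
      weaken (con a) = con a
      weaken (var i) = var (suc i)
      weaken (P ⊕ Q) = weaken P ⊕ weaken Q
      weaken (P ⊗ Q) = weaken P ⊗ weaken Q
      weaken (neg P) = neg (weaken P)

      polynomial-weaken : ∀ P → K.⟪ polynomial P ⟫ ≈ polynomial (weaken P)
      polynomial-weaken (con a) = refl
      polynomial-weaken (var i) = refl
      polynomial-weaken (P ⊕ Q) = trans (K.+-homo _ _) (+-cong (polynomial-weaken P) (polynomial-weaken Q))
      polynomial-weaken (P ⊗ Q) = trans (K.*-homo _ _) (*-cong (polynomial-weaken P) (polynomial-weaken Q))
      polynomial-weaken (neg P) = -‿cong (polynomial-weaken P)

      pair : P₀.Carrier → P₀.Carrier → Carrier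
      pair a b = K.⟪ a ⟫ + X (Pol m) * K.⟪ b ⟫

      pairExpr : Expr F m → Expr F m → Expr F (suc m)
      pairExpr A B = weaken A ⊕ (var zero ⊗ weaken B)

      polynomial-pairExpr : ∀ A B → polynomial (pairExpr A B) ≈ pair (polynomial A) (polynomial B)
      polynomial-pairExpr A B = sym (+-cong (polynomial-weaken A) (*-congˡ {X (Pol m)} (polynomial-weaken B)))

      pair-zero : ∀ {a b} → b P₀.≈ P₀.0# → pair a b ≈ K.⟪ a ⟫
      pair-zero {a} {b} b≈0 = trans
        (+-congˡ {K.⟪ a ⟫} (trans (*-congˡ {X (Pol m)} (trans (K.⟪⟫-cong b≈0) K.0-homo)) (zeroʳ (X (Pol m)))))
        (+-identityʳ K.⟪ a ⟫)

      pair-+ : ∀ a b a′ b′ → pair a b + pair a′ b′ ≈ pair (a P₀.+ a′) (b P₀.+ b′)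
      pair-+ a b a′ b′ = trans
        (solve 5 (λ a b a′ b′ x → (a :+ x :* b) :+ (a′ :+ x :* b′) := (a :+ a′) :+ x :* (b :+ b′)) refl
          K.⟪ a ⟫ K.⟪ b ⟫ K.⟪ a′ ⟫ K.⟪ b′ ⟫ (X (Pol m)))
        (sym (+-cong (K.+-homo a a′) (*-congˡ {X (Pol m)} (K.+-homo b b′))))

      module _ {lam : Fin (suc m) → F.Carrier} where

        -- The remainder of P on division by x₀² + λ₀ is `low P` + x₀ `high P`. The clauses for
        -- products repeat the multiplication of `Quad`, with -λ₀ = λ₀.
        low high : Expr F (suc m) → Expr F m
        low (con a) = con a
        low (var zero) = con F.0#
        low (var (suc i)) = var i
        low (P ⊕ Q) = low P ⊕ low Q
        low (P ⊗ Q) = (low P ⊗ low Q) ⊕ (con (lam zero) ⊗ (high P ⊗ high Q))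
        low (neg P) = neg (low P)
        high (con a) = con F.0#
        high (var zero) = con F.1#
        high (var (suc i)) = con F.0#
        high (P ⊕ Q) = high P ⊕ high Q
        high (P ⊗ Q) = (low P ⊗ high Q) ⊕ (high P ⊗ low Q)
        high (neg P) = neg (high P)

        Generated-generator : Generated lam (polynomial (generator lam zero))
        Generated-generator = h , sym (trans
          (+-cong (trans (*-congʳ {g zero} (C.1-homo (suc m))) (*-identityˡ (g zero)))
            (sum-zero {m} (λ i → polynomial (h (suc i)) * g (suc i))
              (λ i → trans (*-congʳ {g (suc i)} (C.0-homo (suc m))) (zeroˡ (g (suc i))))))
          (+-identityʳ (g zero)))
          where
          open Sum (Pol (suc m))
          g = λ i → polynomial (generator lam i)
          h : Fin (suc m) → Expr F (suc m)
          h zero = con F.1#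
          h (suc i) = con F.0#

        Generated-weaken : ∀ {f} → Generated (lam ∘ suc) f → Generated lam K.⟪ f ⟫
        Generated-weaken {f} (h , e) = h′ , (begin
          K.⟪ f ⟫
            ≈⟨ K.⟪⟫-cong e ⟩
          K.⟪ combination (lam ∘ suc) h ⟫
            ≈⟨ homo-sum {R = Pol m} {S = Pol (suc m)} (constantPoly (Pol m))
                 (λ i → polynomial (h i) P₀.* polynomial (generator (lam ∘ suc) i)) ⟩
          sum (λ i → K.⟪ polynomial (h i) P₀.* polynomial (generator (lam ∘ suc) i) ⟫)
            ≈⟨ sum-cong-≋ (λ i → trans (K.*-homo (polynomial (h i)) (polynomial (generator (lam ∘ suc) i)))
                 (*-cong (polynomial-weaken (h i)) (polynomial-weaken (generator (lam ∘ suc) i)))) ⟩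
          sum (λ i → polynomial (weaken (h i)) * polynomial (generator lam (suc i)))
            ≈⟨ trans (+-congʳ {rest} (trans (*-congʳ {g₀} (C.0-homo (suc m))) (zeroˡ g₀))) (+-identityˡ rest) ⟨
          combination lam h′ ∎)
          where
          open Relation.Binary.Reasoning.Setoid setoid
          open Sum (Pol (suc m))
          g₀ = polynomial (generator lam zero)
          rest = sum (λ i → polynomial (weaken (h i)) * polynomial (generator lam (suc i)))
          h′ : Fin (suc m) → Expr F (suc m)
          h′ zero = con F.0#
          h′ (suc i) = weaken (h i)

        pair-∼ : ∀ {a b a′ b′} → Congruent (lam ∘ suc) a a′ → Congruent (lam ∘ suc) b b′ →
          Congruent lam (pair a b) (pair a′ b′)
        pair-∼ {a} {b} {a′} {b′} (congruent p) (congruent q) = congruent (Generated-resp (sym (pair-+ a b a′ b′))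
          (Generated-+ (Generated-weaken p) (Generated-* (var zero) (Generated-weaken q))))

        ∼-pair : ∀ P → Congruent lam (polynomial P) (pair (polynomial (low P)) (polynomial (high P)))
        ∼-pair (con a) = ≈⇒∼ (sym (pair-zero {polynomial {m} (con a)} (C.0-homo m)))
        ∼-pair (var zero) = ≈⇒∼ (sym (trans
          (+-cong (trans (K.⟪⟫-cong (C.0-homo m)) K.0-homo)
            (trans (*-congˡ {X (Pol m)} (trans (K.⟪⟫-cong (C.1-homo m)) K.1-homo)) (*-identityʳ (X (Pol m)))))
          (+-identityˡ (X (Pol m)))))
        ∼-pair (var (suc i)) = ≈⇒∼ (sym (pair-zero {variablePol {m} i} (C.0-homo m)))
        ∼-pair (P ⊕ Q) = ∼-respʳ
          (pair-+ (polynomial (low P)) (polynomial (high P)) (polynomial (low Q)) (polynomial (high Q)))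
          (∼-+ (∼-pair P) (∼-pair Q))
        ∼-pair (neg P) = ∼-respʳ
          (trans (-x≈x (pair (polynomial (low P)) (polynomial (high P))))
            (sym (+-cong (-x≈x K.⟪ polynomial (low P) ⟫)
              (*-congˡ {X (Pol m)} (-x≈x K.⟪ polynomial (high P) ⟫)))))
          (∼-neg (∼-pair P))
        ∼-pair (P ⊗ Q) = ∼-trans
          (∼-* P (pairExpr (low Q) (high Q)) (∼-pair P)
            (∼-respʳ (sym (polynomial-pairExpr (low Q) (high Q))) (∼-pair Q)))
          -- Multiplying out the two pairs gives b b′ x₀² where the reduced product has λ₀ b b′, so
          -- they differ by b b′ times the generator x₀² + λ₀.
          (congruent (Generated-resp (trans (*-congʳ {g} (sym (polynomial-weaken (high P ⊗ high Q)))) product)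
            (Generated-* (weaken (high P ⊗ high Q)) Generated-generator)))
          where
          a = polynomial (low P)
          b = polynomial (high P)
          a′ = polynomial (low Q)
          b′ = polynomial (high Q)
          s = C.⟪_⟫ m (lam zero)
          g = polynomial (generator lam zero)
          x = X (Pol m)
          product : K.⟪ b P₀.* b′ ⟫ * g ≈ pair a b * polynomial (pairExpr (low Q) (high Q))
            + pair (a P₀.* a′ P₀.+ s P₀.* (b P₀.* b′)) (a P₀.* b′ P₀.+ b P₀.* a′)
          product = begin
            K.⟪ b P₀.* b′ ⟫ * g
              ≈⟨ *-congʳ {g} (K.*-homo b b′) ⟩
            (K.⟪ b ⟫ * K.⟪ b′ ⟫) * (x * x + K.⟪ s ⟫)
              ≈⟨ solve 6 (λ a b a′ b′ s x → (b :* b′) :* (x :* x :+ s)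
                   := (a :+ x :* b) :* (a′ :+ x :* b′)
                     :+ ((a :* a′ :+ s :* (b :* b′)) :+ x :* (a :* b′ :+ b :* a′))) refl
                   K.⟪ a ⟫ K.⟪ b ⟫ K.⟪ a′ ⟫ K.⟪ b′ ⟫ K.⟪ s ⟫ x ⟩
            pair a b * pair a′ b′ + ((K.⟪ a ⟫ * K.⟪ a′ ⟫ + K.⟪ s ⟫ * (K.⟪ b ⟫ * K.⟪ b′ ⟫))
              + x * (K.⟪ a ⟫ * K.⟪ b′ ⟫ + K.⟪ b ⟫ * K.⟪ a′ ⟫))
              ≈⟨ +-cong (*-congˡ {pair a b} (sym (polynomial-pairExpr (low Q) (high Q))))
                   (+-cong (sym (trans (K.+-homo (a P₀.* a′) (s P₀.* (b P₀.* b′)))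
                       (+-cong (K.*-homo a a′) (trans (K.*-homo s (b P₀.* b′)) (*-congˡ {K.⟪ s ⟫} (K.*-homo b b′))))))
                     (*-congˡ {x} (sym (trans (K.+-homo (a P₀.* b′) (b P₀.* a′))
                       (+-cong (K.*-homo a b′) (K.*-homo b a′)))))) ⟩
            pair a b * polynomial (pairExpr (low Q) (high Q))
              + pair (a P₀.* a′ P₀.+ s P₀.* (b P₀.* b′)) (a P₀.* b′ P₀.+ b P₀.* a′) ∎
            where open Relation.Binary.Reasoning.Setoid setoid

    private module Res {m : ℕ} (l : Fin m → F.Carrier) = CommutativeRing (Residue m l)

    residue-pair : ∀ {m} (l : Fin (suc m) → F.Carrier) (P : Expr F (suc m)) →
      Res._≈_ l (residue l P) ( residue (l ∘ suc) (low {lam = squares F l} P)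
                              , residue (l ∘ suc) (high {lam = squares F l} P) )
    residue-pair l (con a) = refl , sym (Hom.0-homo (constantRes _ (l ∘ suc)))
      where open CommutativeRing (Residue _ (l ∘ suc))
    residue-pair l (var zero) = sym (Hom.0-homo (constantRes _ (l ∘ suc))) , sym (Hom.1-homo (constantRes _ (l ∘ suc)))
      where open CommutativeRing (Residue _ (l ∘ suc))
    residue-pair l (var (suc i)) = refl , sym (Hom.0-homo (constantRes _ (l ∘ suc)))
      where open CommutativeRing (Residue _ (l ∘ suc))
    residue-pair l (P ⊕ Q) = Res.+-cong l (residue-pair l P) (residue-pair l Q)
    residue-pair l (P ⊗ Q) = Res.*-cong l (residue-pair l P) (residue-pair l Q)
    residue-pair l (neg P) = Res.-‿cong l (residue-pair l P)

    -- This identifies the kernel of `residue` with the ideal. Modulo the ideal both expressions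
    -- reduce to `low` + x₀ `high`; by `residue-pair` the respective parts have equal residues in
    -- one variable less, and without variables the residue is the polynomial itself.
    residue-injective : ∀ m (l : Fin m → F.Carrier) P Q → Res._≈_ l (residue l P) (residue l Q) →
      Congruent (squares F l) (polynomial P) (polynomial Q)
    residue-injective zero l P Q e = ≈⇒∼
      (F.trans (project-polynomial l P) (F.trans e (F.sym (project-polynomial l Q))))
    residue-injective (suc m) l P Q e = ∼-trans (∼-pair P) (∼-trans
      (pair-∼ (residue-injective m (l ∘ suc) (low P) (low Q) (proj₁ e′))
              (residue-injective m (l ∘ suc) (high P) (high Q) (proj₂ e′)))
      (∼-sym (∼-pair Q)))
      where e′ = Res.trans l (Res.sym l (residue-pair l P)) (Res.trans l e (residue-pair l Q))

    residue≈⇒InIdeal : ∀ {m} (l : Fin m → F.Carrier) P Q → Res._≈_ l (residue l P) (residue l Q) →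
      InIdeal F (squares F l) (P ⊕ neg Q)
    residue≈⇒InIdeal {m} l P Q e = Generated⇒InIdeal {P = P ⊕ neg Q}
      (Generated-resp (P.+-congˡ m (P.sym m (-x≈x (polynomial Q)))) (Congruent.generated (residue-injective m l P Q e)))
      where open Char2Ring (Pol m) (C.homo-char2 m two≈0)

    InIdeal⇒residue≈ : ∀ {m} (l : Fin m → F.Carrier) P Q → InIdeal F (squares F l) (P ⊕ neg Q) →
      Res._≈_ l (residue l P) (residue l Q)
    InIdeal⇒residue≈ {m} l P Q ideal = x+y≈0⇒x≈y (trans (+-congˡ (sym (-x≈x (residue l Q)))) zero-residue)
      where
      open CommutativeRing (Residue m l) hiding (zero)
      open Char2Ring (Residue m l) (Hom.homo-char2 (constantRes m l) two≈0)
      module π = Hom (project m l)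
      h = proj₁ ideal
      zero-residue : residue l (P ⊕ neg Q) ≈ 0#
      zero-residue = begin
        residue l (P ⊕ neg Q)
          ≈⟨ project-polynomial l (P ⊕ neg Q) ⟨
        π.⟪ polynomial (P ⊕ neg Q) ⟫
          ≈⟨ π.⟪⟫-cong (≋⇒polynomial≈ {P = P ⊕ neg Q} {Q = ideal-expr} (proj₂ ideal)) ⟩
        π.⟪ polynomial ideal-expr ⟫
          ≈⟨ project-polynomial l ideal-expr ⟩
        residue l ideal-expr
          ≈⟨ eval-ΣE (Residue m l) (constantRes m l) (variableRes m l) (λ i → h i ⊗ generator (squares F l) i) ⟩
        Sum.sum (Residue m l) (λ i → residue l (h i ⊗ generator (squares F l) i))
          -- In the residue ring xᵢ² is the constant ℓᵢ², so each generator becomes ℓᵢ² + ℓᵢ² = 0.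
          ≈⟨ Sum.sum-zero (Residue m l) (λ i → residue l (h i ⊗ generator (squares F l) i)) (λ i →
               trans (*-congˡ (trans (+-congʳ (variableRes-square m l i)) (x+x≈0 _))) (zeroʳ _)) ⟩
        0# ∎
        where
        open Relation.Binary.Reasoning.Setoid setoid
        ideal-expr = ΣE F (λ i → h i ⊗ generator (squares F l) i)

-- Degree bounds and bordered matrices

module _ {c ℓ : Level} where

  module Degree (F : CommutativeRing c ℓ) where
    open CommutativeRing F hiding (zero)
    open Algebra.Properties.Group (AbelianGroup.group +-abelianGroup) using (ε⁻¹≈ε)

    -- The bound is strict: 1 says that the variable is absent, 2 that its degree is at most one.
    DegreeBelow : ∀ {m} → ℕ → Fin m → Expr F m → Set ℓ
    DegreeBelow d i P = ∀ α → d ℕ.≤ lookup α i → coeff F P α ≈ 0#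

    isZeroMono-vanishes : ∀ {m} (i : Fin m) α a → 1 ℕ.≤ lookup α i → isZeroMono F α a ≈ 0#
    isZeroMono-vanishes i (suc k ∷ α) a le = refl
    isZeroMono-vanishes (suc i) (zero ∷ α) a le = isZeroMono-vanishes i α a le

    con-degree : ∀ {m} (i : Fin m) a → DegreeBelow 1 i (con a)
    con-degree i a α = isZeroMono-vanishes i α a

    var-degree : ∀ {m} (i j : Fin m) → j ≢ i → DegreeBelow 1 i (var j)
    var-degree zero zero j≢i = contradiction ≡.refl j≢i
    var-degree zero (suc j) j≢i (suc k ∷ α) le = refl
    var-degree (suc i) zero j≢i (zero ∷ α) le = refl
    var-degree (suc i) zero j≢i (1 ∷ α) le = isZeroMono-vanishes i α 1# le
    var-degree (suc i) zero j≢i (suc (suc k) ∷ α) le = refl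
    var-degree (suc i) (suc j) j≢i (zero ∷ α) le = var-degree i j (j≢i ∘ ≡.cong suc) α le
    var-degree (suc i) (suc j) j≢i (suc k ∷ α) le = refl

    var-degree-self : ∀ {m} (i : Fin m) → DegreeBelow 2 i (var i)
    var-degree-self zero (1 ∷ α) (s≤s ())
    var-degree-self zero (suc (suc k) ∷ α) le = refl
    var-degree-self (suc i) (zero ∷ α) le = var-degree-self i α le
    var-degree-self (suc i) (suc k ∷ α) le = refl

    relax-degree : ∀ {m} {i : Fin m} {d e} P → d ℕ.≤ e → DegreeBelow d i P → DegreeBelow e i P
    relax-degree P d≤e deg α le = deg α (ℕ.≤-trans d≤e le)

    lookup-monus : ∀ {m} (α β : Mono F m) i → lookup (monus F α β) i ≡ lookup α i ∸ lookup β i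
    lookup-monus (a ∷ α) (b ∷ β) zero = ≡.refl
    lookup-monus (a ∷ α) (b ∷ β) (suc i) = lookup-monus α β i

    ⊕-degree : ∀ {m} {i : Fin m} {d} P Q → DegreeBelow d i P → DegreeBelow d i Q → DegreeBelow d i (P ⊕ Q)
    ⊕-degree P Q degP degQ α le = trans (+-cong (degP α le) (degQ α le)) (+-identityˡ 0#)

    neg-degree : ∀ {m} {i : Fin m} {d} P → DegreeBelow d i P → DegreeBelow d i (neg P)
    neg-degree P deg α le = trans (-‿cong (deg α le)) ε⁻¹≈ε

    -- The exponents of i in the two monomials of a term add up to more than a + b. So either the
    -- first exceeds a or the second exceeds b, and one coefficient vanishes.
    ⊗-degree : ∀ {m} {i : Fin m} a b P Q → DegreeBelow (suc a) i P → DegreeBelow (suc b) i Q →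
      DegreeBelow (suc (a ℕ.+ b)) i (P ⊗ Q)
    ⊗-degree {i = i} a b P Q degP degQ α le = sum-vanishes (below F α) λ β → term β (suc a ℕ.≤? lookup β i)
      where
      sum-vanishes : ∀ {A : Set} {h : A → Carrier} xs → (∀ x → h x ≈ 0#) → sumR F (map h xs) ≈ 0#
      sum-vanishes [] h≈0 = refl
      sum-vanishes (x ∷ xs) h≈0 = trans (+-cong (h≈0 x) (sum-vanishes xs h≈0)) (+-identityˡ 0#)
      remaining : ∀ β → lookup β i ℕ.≤ a → suc b ℕ.≤ lookup (monus F α β) i
      remaining β β≤a = ≡.subst₂ ℕ._≤_
        (≡.trans (≡.cong (_∸ a) (≡.sym (ℕ.+-suc a b))) (ℕ.m+n∸m≡n a (suc b)))
        (≡.sym (lookup-monus α β i)) (ℕ.∸-mono le β≤a)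
      term : ∀ β → Dec (suc a ℕ.≤ lookup β i) → coeff F P β * coeff F Q (monus F α β) ≈ 0#
      term β (yes a<β) = trans (*-congʳ (degP β a<β)) (zeroˡ _)
      term β (no a≮β) = trans (*-congˡ (degQ (monus F α β) (remaining β (ℕ.≮⇒≥ a≮β)))) (zeroʳ _)

    ΣE-degree : ∀ {m n} {i : Fin m} {d} (f : Fin n → Expr F m) →
      (∀ j → DegreeBelow (suc d) i (f j)) → DegreeBelow (suc d) i (ΣE F f)
    ΣE-degree {n = zero} f deg = relax-degree (con 0#) (s≤s z≤n) (con-degree _ 0#)
    ΣE-degree {n = suc n} f deg =
      ⊕-degree (f zero) (ΣE F (f ∘ suc)) (deg zero) (ΣE-degree (f ∘ suc) (deg ∘ suc))

    sign-degree : ∀ {m} {i : Fin m} {d} k P → DegreeBelow d i P → DegreeBelow d i (sign F k P)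
    sign-degree zero P deg = deg
    sign-degree (suc k) P deg = neg-degree (sign F k P) (sign-degree k P deg)

    private
      minor : ∀ {m n} → (Fin (suc n) → Fin (suc n) → Expr F m) → Fin (suc n) → Fin n → Fin n → Expr F m
      minor M j r s = M (suc r) (punchIn j s)

    det-degree-free : ∀ {m n} {i : Fin m} (M : Fin n → Fin n → Expr F m) →
      (∀ r s → DegreeBelow 1 i (M r s)) → DegreeBelow 1 i (det F M)
    det-degree-free {n = zero} M deg = con-degree _ 1#
    det-degree-free {n = suc n} M deg = ΣE-degree
      (λ j → sign F (toℕ j) (M zero j ⊗ det F (minor M j))) λ j →
      sign-degree (toℕ j) (M zero j ⊗ det F (minor M j))
        (⊗-degree 0 0 (M zero j) (det F (minor M j)) (deg zero j)
          (det-degree-free (minor M j) (λ r s → deg (suc r) (punchIn j s))))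

    -- Each product in the Laplace expansion takes exactly one entry from row p, so the variable is
    -- picked up at most once.
    det-degree-row : ∀ {m n} {i : Fin m} (M : Fin n → Fin n → Expr F m) p →
      (∀ s → DegreeBelow 2 i (M p s)) → (∀ r s → r ≢ p → DegreeBelow 1 i (M r s)) →
      DegreeBelow 2 i (det F M)
    det-degree-row {n = suc n} M zero deg-row deg = ΣE-degree
      (λ j → sign F (toℕ j) (M zero j ⊗ det F (minor M j))) λ j →
      sign-degree (toℕ j) (M zero j ⊗ det F (minor M j))
        (⊗-degree 1 0 (M zero j) (det F (minor M j)) (deg-row j)
          (det-degree-free (minor M j) (λ r s → deg (suc r) (punchIn j s) λ ())))
    det-degree-row {n = suc n} M (suc p) deg-row deg = ΣE-degree
      (λ j → sign F (toℕ j) (M zero j ⊗ det F (minor M j))) λ j →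
      sign-degree (toℕ j) (M zero j ⊗ det F (minor M j))
        (⊗-degree 0 1 (M zero j) (det F (minor M j)) (deg zero j λ ())
          (det-degree-row (minor M j) p (λ s → deg-row (punchIn j s))
            (λ r s r≢p → deg (suc r) (punchIn j s) (r≢p ∘ Fin.suc-injective))))

gadgetSize : ℕ → ℕ → ℕ
gadgetSize k zero = k
gadgetSize k (suc t) = suc (suc (gadgetSize k t))

-- Of the two rows added for a variable, the second has it on the diagonal.
variableRow : ∀ {k} t → Fin t → Fin (gadgetSize k t)
variableRow (suc t) zero = suc zero
variableRow (suc t) (suc i) = suc (suc (variableRow t i))

module _ {x : Level} {X : Set x} (z o : X) where

  -- Zeros stand at the indices added for other variables, so the rank-one matrix of `pad t v` lives
  -- on the last k indices.
  pad : ∀ {k} t → (Fin k → X) → Fin (gadgetSize k t) → X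
  pad zero v = v
  pad (suc t) v zero = z
  pad (suc t) v (suc zero) = z
  pad (suc t) v (suc (suc i)) = pad t v i

  -- The bordered matrix whose determinant is that of A + ∑ᵢ xᵢ vᵢ vᵢᵀ, each xᵢ occurring once.
  gadgets : ∀ {k} t → (Fin t → X) → (Fin t → Fin k → X) → (Fin k → Fin k → X) →
    Fin (gadgetSize k t) → Fin (gadgetSize k t) → X
  gadgets zero x v A = A
  gadgets (suc t) x v A = border z o (x zero) (pad t (v zero)) (gadgets t (x ∘ suc) (v ∘ suc) A)

  module _ {p : Level} (P : X → Set p) (Pz : P z) (Po : P o) where

    pad-all : ∀ {k} t {v : Fin k → X} → (∀ i → P (v i)) → ∀ i → P (pad t v i)
    pad-all zero Pv = Pv
    pad-all (suc t) Pv zero = Pz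
    pad-all (suc t) Pv (suc zero) = Pz
    pad-all (suc t) Pv (suc (suc i)) = pad-all t Pv i

    module _ {k : ℕ} {A : Fin k → Fin k → X} (PA : ∀ i j → P (A i j)) where

      gadgets-all : ∀ t {x v} → (∀ s → P (x s)) → (∀ s i → P (v s i)) → ∀ i j → P (gadgets t x v A i j)
      gadgets-all zero Px Pv i j = PA i j
      gadgets-all (suc t) Px Pv zero zero = Pz
      gadgets-all (suc t) Px Pv zero (suc zero) = Po
      gadgets-all (suc t) Px Pv zero (suc (suc j)) = pad-all t (Pv zero) j
      gadgets-all (suc t) Px Pv (suc zero) zero = Po
      gadgets-all (suc t) Px Pv (suc zero) (suc zero) = Px zero
      gadgets-all (suc t) Px Pv (suc zero) (suc (suc j)) = Pz
      gadgets-all (suc t) Px Pv (suc (suc i)) zero = pad-all t (Pv zero) i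
      gadgets-all (suc t) Px Pv (suc (suc i)) (suc zero) = Pz
      gadgets-all (suc t) Px Pv (suc (suc i)) (suc (suc j)) = gadgets-all t (Px ∘ suc) (Pv ∘ suc) i j

      -- With P the absence of the variable q, this says that it occurs in no other row, as
      -- `det-degree-row` requires.
      gadgets-otherRows : ∀ t {x v} q → (∀ s → s ≢ q → P (x s)) → (∀ s i → P (v s i)) →
        ∀ i j → i ≢ variableRow t q → P (gadgets t x v A i j)
      gadgets-otherRows (suc t) q Px Pv zero zero i≢ = Pz
      gadgets-otherRows (suc t) q Px Pv zero (suc zero) i≢ = Po
      gadgets-otherRows (suc t) q Px Pv zero (suc (suc j)) i≢ = pad-all t (Pv zero) j
      gadgets-otherRows (suc t) q Px Pv (suc zero) zero i≢ = Po
      gadgets-otherRows (suc t) zero Px Pv (suc zero) (suc zero) i≢ = contradiction ≡.refl i≢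
      gadgets-otherRows (suc t) (suc q) Px Pv (suc zero) (suc zero) i≢ = Px zero λ ()
      gadgets-otherRows (suc t) q Px Pv (suc zero) (suc (suc j)) i≢ = Pz
      gadgets-otherRows (suc t) q Px Pv (suc (suc i)) zero i≢ = pad-all t (Pv zero) i
      gadgets-otherRows (suc t) q Px Pv (suc (suc i)) (suc zero) i≢ = Pz
      gadgets-otherRows (suc t) zero Px Pv (suc (suc i)) (suc (suc j)) i≢ =
        gadgets-all t (λ s → Px (suc s) λ ()) (Pv ∘ suc) i j
      gadgets-otherRows (suc t) (suc q) Px Pv (suc (suc i)) (suc (suc j)) i≢ =
        gadgets-otherRows t q (λ s s≢q → Px (suc s) (s≢q ∘ Fin.suc-injective)) (Pv ∘ suc) i j
          (λ eq → i≢ (≡.cong (λ i → suc (suc i)) eq))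

  module _ {p : Level} (_~_ : X → X → Set p) (~-refl : ∀ a → a ~ a) where

    gadgets-symmetric : ∀ {k} t x v {A : Fin k → Fin k → X} → (∀ i j → A i j ~ A j i) →
      ∀ i j → gadgets t x v A i j ~ gadgets t x v A j i
    gadgets-symmetric zero x v A-sym = A-sym
    gadgets-symmetric (suc t) x v A-sym zero zero = ~-refl _
    gadgets-symmetric (suc t) x v A-sym zero (suc zero) = ~-refl _
    gadgets-symmetric (suc t) x v A-sym zero (suc (suc j)) = ~-refl _
    gadgets-symmetric (suc t) x v A-sym (suc zero) zero = ~-refl _
    gadgets-symmetric (suc t) x v A-sym (suc zero) (suc zero) = ~-refl _
    gadgets-symmetric (suc t) x v A-sym (suc zero) (suc (suc j)) = ~-refl _
    gadgets-symmetric (suc t) x v A-sym (suc (suc i)) zero = ~-refl _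
    gadgets-symmetric (suc t) x v A-sym (suc (suc i)) (suc zero) = ~-refl _
    gadgets-symmetric (suc t) x v A-sym (suc (suc i)) (suc (suc j)) =
      gadgets-symmetric t (x ∘ suc) (v ∘ suc) A-sym i j

module _ {c ℓ : Level} where

  module Gadgets (R : CommutativeRing c ℓ) where
    open CommutativeRing R hiding (zero)
    open Sum R
    open Grassmann R

    module _ {x : Level} {X : Set x} (f : X → Carrier) {z o : X} (z↦0 : f z ≈ 0#) (o↦1 : f o ≈ 1#) where

      pad-map : ∀ {k} t (v : Fin k → X) i → f (pad z o t v i) ≈ pad 0# 1# t (f ∘ v) i
      pad-map zero v i = refl
      pad-map (suc t) v zero = z↦0
      pad-map (suc t) v (suc zero) = z↦0
      pad-map (suc t) v (suc (suc i)) = pad-map t v i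

      gadgets-map : ∀ {k} t x v (A : Fin k → Fin k → X) i j →
        f (gadgets z o t x v A i j) ≈ gadgets 0# 1# t (f ∘ x) (λ s → f ∘ v s) (λ i j → f (A i j)) i j
      gadgets-map zero x v A i j = refl
      gadgets-map (suc t) x v A zero zero = z↦0
      gadgets-map (suc t) x v A zero (suc zero) = o↦1
      gadgets-map (suc t) x v A zero (suc (suc j)) = pad-map t (v zero) j
      gadgets-map (suc t) x v A (suc zero) zero = o↦1
      gadgets-map (suc t) x v A (suc zero) (suc zero) = refl
      gadgets-map (suc t) x v A (suc zero) (suc (suc j)) = z↦0
      gadgets-map (suc t) x v A (suc (suc i)) zero = pad-map t (v zero) i
      gadgets-map (suc t) x v A (suc (suc i)) (suc zero) = z↦0
      gadgets-map (suc t) x v A (suc (suc i)) (suc (suc j)) = gadgets-map t (x ∘ suc) (v ∘ suc) A i j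

    private
      absorbˡ : ∀ a y w → a + (y * 0#) * w ≈ a
      absorbˡ a y w = trans (+-congˡ (trans (*-congʳ (zeroʳ y)) (zeroˡ w))) (+-identityʳ a)

      absorbʳ : ∀ a y → a + y * 0# ≈ a
      absorbʳ a y = trans (+-congˡ (zeroʳ y)) (+-identityʳ a)

    -- `pad` vanishes at all bordering indices, so a rank-one term added to the large matrix changes
    -- only the inner block A.
    gadgets-rankOne : ∀ {k} t x v (A : Mat R k) y (w : Fin k → Carrier) i j →
      gadgets 0# 1# t x v A i j + (y * pad 0# 1# t w i) * pad 0# 1# t w j
      ≈ gadgets 0# 1# t x v (λ i j → A i j + (y * w i) * w j) i j
    gadgets-rankOne zero x v A y w i j = refl
    gadgets-rankOne (suc t) x v A y w zero j = trans (absorbˡ _ y _) (firstRow j)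
      where
      firstRow : ∀ j → gadgets 0# 1# (suc t) x v A zero j
        ≈ gadgets 0# 1# (suc t) x v (λ i j → A i j + (y * w i) * w j) zero j
      firstRow zero = refl
      firstRow (suc zero) = refl
      firstRow (suc (suc j)) = refl
    gadgets-rankOne (suc t) x v A y w (suc zero) j = trans (absorbˡ _ y _) (secondRow j)
      where
      secondRow : ∀ j → gadgets 0# 1# (suc t) x v A (suc zero) j
        ≈ gadgets 0# 1# (suc t) x v (λ i j → A i j + (y * w i) * w j) (suc zero) j
      secondRow zero = refl
      secondRow (suc zero) = refl
      secondRow (suc (suc j)) = refl
    gadgets-rankOne (suc t) x v A y w (suc (suc i)) zero = absorbʳ _ _
    gadgets-rankOne (suc t) x v A y w (suc (suc i)) (suc zero) = absorbʳ _ _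
    gadgets-rankOne (suc t) x v A y w (suc (suc i)) (suc (suc j)) =
      gadgets-rankOne t (x ∘ suc) (v ∘ suc) A y w i j

    -- The borders are removed from the outside inwards. Each leaves a rank-one term on the matrix
    -- inside it, and `gadgets-rankOne` moves this term into A before the next border is removed.
    top-gaussian-gadgets : Char2 R → ∀ {k} t (x : Fin t → Carrier) (v : Fin t → Fin k → Carrier) (A : Mat R k) →
      top (gadgetSize k t) (gaussian (gadgetSize k t) (gadgets 0# 1# t x v A))
      ≈ top k (gaussian k (λ i j → A i j + sum (λ s → (x s * v s i) * v s j)))
    top-gaussian-gadgets two≈0 {k} zero x v A =
      top-cong k (gaussian-cong k (λ i j → sym (+-identityʳ (A i j))))
    top-gaussian-gadgets two≈0 {k} (suc t) x v A = begin
      top (suc (suc n)) (gaussian (suc (suc n)) (gadgets 0# 1# (suc t) x v A))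
        ≈⟨ top-gaussian-border R two≈0 (x zero) (pad 0# 1# t (v zero)) (gadgets 0# 1# t (x ∘ suc) (v ∘ suc) A) ⟩
      _ ≈⟨ top-cong n (gaussian-cong n (gadgets-rankOne t (x ∘ suc) (v ∘ suc) A (x zero) (v zero))) ⟩
      _ ≈⟨ top-gaussian-gadgets two≈0 t (x ∘ suc) (v ∘ suc) (λ i j → A i j + (x zero * v zero i) * v zero j) ⟩
      _ ≈⟨ top-cong k (gaussian-cong k (λ i j → +-assoc _ _ _)) ⟩
      top k (gaussian k (λ i j → A i j + sum (λ s → (x s * v s i) * v s j))) ∎
      where
      open Relation.Binary.Reasoning.Setoid setoid
      n = gadgetSize k t

-- Representability and factorizability

module _ {c ℓ : Level} where

  module Representability (F : CommutativeRing c ℓ) (finite : IsFiniteField F) (two≈0 : Char2 F) where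
    open IsFiniteField finite using (inverse; size; to; from; from-to)
    open FiniteChar2 F finite two≈0
    open Evaluation F
    open Ideal F two≈0
    open Multivariate F
    open Degree F
    private
      module F = CommutativeRing F
      module Res {m : ℕ} (l : Fin m → F.Carrier) = CommutativeRing (Residue m l)

    module SquareRoot where
      open CommutativeRing F hiding (zero)
      open Char2Ring F two≈0
      open Solver

      square≈0⇒≈0 : ∀ {x} → x * x ≈ 0# → x ≈ 0#
      square≈0⇒≈0 {x} x²≈0 = byCases (x ≟F 0#)
        where
        byCases : Dec (x ≈ 0#) → x ≈ 0#
        byCases (yes x≈0) = x≈0
        byCases (no x≉0) with y , xy≈1 ← inverse x x≉0 =
          trans (sym (*-identityʳ x)) (trans (*-congˡ (sym xy≈1))
            (trans (sym (*-assoc x x y)) (trans (*-congʳ x²≈0) (zeroˡ y))))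

      square-injective : ∀ {x y} → x * x ≈ y * y → x ≈ y
      square-injective {x} {y} x²≈y² = x+y≈0⇒x≈y (square≈0⇒≈0 (trans
        (solve 2 (λ x y → (x :+ y) :* (x :+ y) := x :* x :+ y :* y) refl x y)
        (trans (+-congʳ x²≈y²) (x+x≈0 (y * y)))))

      frobenius : Carrier → ℕ → Carrier
      frobenius x zero = x
      frobenius x (suc n) = frobenius x n * frobenius x n

      -- Injectivity removes one squaring from both sides until the left side is x itself; the right
      -- side, having squarings left, is then a square.
      frobenius-cancel : ∀ {x} i j → i ℕ.< j → frobenius x i ≈ frobenius x j → ∃ λ y → y * y ≈ x
      frobenius-cancel {x} zero (suc j) i<j eq = frobenius x j , sym eq
      frobenius-cancel (suc i) (suc j) (s≤s i<j) eq = frobenius-cancel i j i<j (square-injective eq)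

      -- Some two of x, x², x⁴, … coincide, and the Frobenius map is injective.
      squareRoot : ∀ x → ∃ λ y → y * y ≈ x
      squareRoot x with i , j , i<j , eq ← Fin.pigeonhole (ℕ.n<1+n size) (λ (i : Fin (suc size)) → to (frobenius x (toℕ i))) =
        frobenius-cancel (toℕ i) (toℕ j) i<j
          (trans (sym (from-to _)) (trans (reflexive (≡.cong from eq)) (from-to _)))

    open SquareRoot using (squareRoot)

    residueLinearity : ∀ m l → Linearity (Residue m l)
    -- The constants of `Residue` and those of the linearity structure are built separately. Their
    -- agreement shows that the square adjoined next is t² for a constant t, so it is proved along
    -- with `residueLinearity`.
    constantRes≈ : ∀ m l a → Res._≈_ l (Hom.⟪_⟫ (constantRes m l) a) (Linearity.κ.⟪_⟫ (residueLinearity m l) a)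

    residueLinearity zero l = baseLinearity
    residueLinearity (suc m) l = quadLinearity {R = Residue m (l ∘ suc)} (residueLinearity m (l ∘ suc)) (l zero)
      {s = Hom.⟪_⟫ (constantRes m (l ∘ suc)) (squares F l zero)} (constantRes≈ m (l ∘ suc) (squares F l zero))

    constantRes≈ zero l a = F.refl
    constantRes≈ (suc m) l a = constantRes≈ m (l ∘ suc) a , Res.refl (l ∘ suc)

    private
      module L {m : ℕ} (l : Fin m → F.Carrier) = Linearity (residueLinearity m l)
      module K {m : ℕ} (l : Fin m → F.Carrier) = Hom (constantRes m l)

    Linear-constantRes : ∀ {m} l a → L.Linear {m} l (K.⟪_⟫ l a)
    Linear-constantRes {m} l a = L.Linear-resp l (Res.sym l (constantRes≈ m l a)) (L.Linear-constant l a)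

    Linear-variableRes : ∀ m l i → L.Linear {m} l (variableRes m l i)
    Linear-variableRes (suc m) l zero = L.Linear-0# (l ∘ suc) , F.1# , Res.sym (l ∘ suc) (L.κ.1-homo (l ∘ suc))
    Linear-variableRes (suc m) l (suc i) = Linear-variableRes m (l ∘ suc) i , F.0# , Res.sym (l ∘ suc) (L.κ.0-homo (l ∘ suc))

    value-constant : ∀ {m} l a → L.ρ.⟪_⟫ {m} l (K.⟪_⟫ l a) F.≈ a
    value-constant {m} l a = F.trans (L.ρ.⟪⟫-cong l (constantRes≈ m l a)) (L.residue-constant l a)

    value-variable : ∀ m l i → L.ρ.⟪_⟫ {m} l (variableRes m l i) F.≈ l i
    value-variable (suc m) l zero = F.trans
      (F.+-cong (L.ρ.0-homo (l ∘ suc)) (F.trans (F.*-congˡ (L.ρ.1-homo (l ∘ suc))) (F.*-identityʳ (l zero))))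
      (F.+-identityˡ (l zero))
    value-variable (suc m) l (suc i) = F.trans
      (F.+-cong (value-variable m (l ∘ suc) i) (F.trans (F.*-congˡ (L.ρ.0-homo (l ∘ suc))) (F.zeroʳ (l zero))))
      (F.+-identityʳ (l (suc i)))

    residue-linearExpr : ∀ {m} l a₀ (a : Fin m → F.Carrier) → Res._≈_ l (residue l (linearExpr F a₀ a))
      (Res._+_ l (K.⟪_⟫ l a₀) (Sum.sum (Residue m l) (λ i → Res._*_ l (K.⟪_⟫ l (a i)) (variableRes m l i))))
    residue-linearExpr {m} l a₀ a = Res.+-congˡ l
      (eval-ΣE (Residue m l) (constantRes m l) (variableRes m l) (λ i → con (a i) ⊗ var i))

    private
      module Step {m : ℕ} (l : Fin (suc m) → F.Carrier) where
        open CommutativeRing (Residue m (l ∘ suc)) hiding (zero) public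
        module S = Algebra.Solver.Ring.NaturalCoefficients.Default commutativeSemiring
        open S public using (_:=_; _:+_; _:*_)
        κ = K.⟪_⟫ (l ∘ suc)
        s = κ (squares F l zero)
        x = variableRes m (l ∘ suc)

    residue-ΣE-suc : ∀ {m n} (l : Fin (suc m) → F.Carrier) (a : Fin n → F.Carrier) (g : Fin n → Fin m) →
      Res._≈_ l (residue l (ΣE F (λ i → con (a i) ⊗ var (suc (g i)))))
        (residue (l ∘ suc) (ΣE F (λ i → con (a i) ⊗ var (g i))) , Res.0# (l ∘ suc))
    residue-ΣE-suc {n = zero} l a g = Res.refl (l ∘ suc) , Res.refl (l ∘ suc)
    residue-ΣE-suc {n = suc n} l a g =
        +-cong (S.solve 3 (λ a x s → a :* x :+ s :* (S.con 0 :* S.con 0) := a :* x) refl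
          (κ (a zero)) (x (g zero)) s) (proj₁ rest)
      , trans (+-congˡ (proj₂ rest))
          (S.solve 2 (λ a x → (a :* S.con 0 :+ S.con 0 :* x) :+ S.con 0 := S.con 0) refl (κ (a zero)) (x (g zero)))
      where
      open Step l
      rest = residue-ΣE-suc l (a ∘ suc) (g ∘ suc)

    linearExpr-∷ : ∀ {m} (l : Fin (suc m) → F.Carrier) a₀ a₁ (a : Fin m → F.Carrier) → Res._≈_ l
      (residue l (linearExpr F a₀ (a₁ Functional.∷ a)))
      (residue (l ∘ suc) (linearExpr F a₀ a) , K.⟪_⟫ (l ∘ suc) a₁)
    linearExpr-∷ l a₀ a₁ a =
        +-congˡ (trans (+-congˡ (proj₁ tail≈))
          (S.solve 3 (λ a t s → (a :* S.con 0 :+ s :* (S.con 0 :* S.con 1)) :+ t := t) refl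
            (κ a₁) (residue (l ∘ suc) (ΣE F (λ i → con (a i) ⊗ var i))) s))
      , trans (+-congˡ (+-congˡ (proj₂ tail≈)))
          (S.solve 1 (λ a → S.con 0 :+ ((a :* S.con 1 :+ S.con 0 :* S.con 0) :+ S.con 0) := a) refl (κ a₁))
      where
      open Step l
      tail≈ = residue-ΣE-suc l a id

    Linear⇒linearExpr : ∀ m l {x} → L.Linear {m} l x →
      ∃ λ a₀ → ∃ λ a → Res._≈_ l x (residue l (linearExpr F a₀ a))
    Linear⇒linearExpr zero l {x} _ = x , (λ ()) , F.sym (F.+-identityʳ x)
    Linear⇒linearExpr (suc m) l {x , y} (lin , e , y≈e) = extend (Linear⇒linearExpr m (l ∘ suc) lin)
      where
      open CommutativeRing (Residue m (l ∘ suc))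
      extend : (∃ λ a₀ → ∃ λ a → x ≈ residue (l ∘ suc) (linearExpr F a₀ a)) →
        ∃ λ a₀ → ∃ λ a → Res._≈_ l (x , y) (residue l (linearExpr F a₀ a))
      extend (a₀ , a , x≈) = a₀ , (e Functional.∷ a)
        , trans x≈ (sym (proj₁ (linearExpr-∷ l a₀ e a)))
        , trans y≈e (trans (sym (constantRes≈ m (l ∘ suc) e)) (sym (proj₂ (linearExpr-∷ l a₀ e a))))

    Factors⇒ΠE : ∀ {m} l {x} → Factors (residueLinearity m l) x →
      Σ ℕ λ k → Σ (Fin k → F.Carrier) λ a₀ → Σ (Fin k → Fin m → F.Carrier) λ a →
        Res._≈_ l x (residue l (ΠE F (λ j → linearExpr F (a₀ j) (a j))))
    Factors⇒ΠE l (unit x≈1) = 0 , (λ ()) , (λ ()) , Res.trans l x≈1 (Res.sym l (K.1-homo l))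
    Factors⇒ΠE {m} l {x} (mul {y = y} {z = z} lin f x≈yz) = extend (Linear⇒linearExpr m l lin) (Factors⇒ΠE l f)
      where
      extend : (∃ λ a₀ → ∃ λ a → Res._≈_ l y (residue l (linearExpr F a₀ a))) →
        (Σ ℕ λ k → Σ (Fin k → F.Carrier) λ a₀ → Σ (Fin k → Fin m → F.Carrier) λ a →
          Res._≈_ l z (residue l (ΠE F (λ j → linearExpr F (a₀ j) (a j))))) →
        Σ ℕ λ k → Σ (Fin k → F.Carrier) λ a₀ → Σ (Fin k → Fin m → F.Carrier) λ a →
          Res._≈_ l x (residue l (ΠE F (λ j → linearExpr F (a₀ j) (a j))))
      extend (b₀ , b , y≈) (k , a₀ , a , z≈) = suc k , (b₀ Functional.∷ a₀) , (b Functional.∷ a) ,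
        Res.trans l x≈yz (Res.*-cong l y≈ z≈)

    residue-det : ∀ {m n} l (M : Fin n → Fin n → Entry F m) → Symmetric F M →
      let N = λ i j → residue l (entryExpr F (M i j)) in
      Res._≈_ l (residue l (det F (λ i j → entryExpr F (M i j))))
        (Grassmann.top (Residue m l) n (Grassmann.gaussian (Residue m l) n N))
    residue-det {m} {n} l M M-sym = Res.trans l
      (eval-det (Residue m l) (constantRes m l) (variableRes m l) two≈0 (λ i j → entryExpr F (M i j)))
      (Grassmann.unsignedDet≈top (Residue m l) (L.char2 l) n (λ i j → residue l (entryExpr F (M i j)))
        (λ i j → entry-cong (M i j) (M j i) (M-sym i j)))
      where
      entry-cong : ∀ (e e′ : Entry F m) → _≈ᴱ_ F e e′ → Res._≈_ l (residue l (entryExpr F e)) (residue l (entryExpr F e′))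
      entry-cong (inj₁ a) (inj₁ b) a≈b = K.⟪⟫-cong l a≈b
      entry-cong (inj₂ i) (inj₂ .i) (lift ≡.refl) = Res.refl l

    representable⇒factorizable : ∀ {m} (P : Expr F m) → Representable F P →
      ∀ l → FactorizableMod F (squares F l) P
    representable⇒factorizable {m} P (n , M , M-sym , det≋P) l =
      extend (Factors⇒ΠE l (Factors-resp (residueLinearity m l) residue≈
        (Factors-top (residueLinearity m l) n (Factors-gaussian (residueLinearity m l) n N (λ i → linear (M i i))))))
      where
      N = λ i j → residue l (entryExpr F (M i j))
      D = det F (λ i j → entryExpr F (M i j))
      linear : ∀ e → L.Linear l (residue l (entryExpr F e))
      linear (inj₁ a) = Linear-constantRes l a
      linear (inj₂ i) = Linear-variableRes m l i
      residue≈ : Res._≈_ l (Grassmann.top (Residue m l) n (Grassmann.gaussian (Residue m l) n N)) (residue l P)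
      residue≈ = Res.trans l (Res.sym l (residue-det l M M-sym))
        (Res.trans l (Res.sym l (project-polynomial l D))
          (Res.trans l (Hom.⟪⟫-cong (project m l) (≋⇒polynomial≈ {P = D} {Q = P} det≋P)) (project-polynomial l P)))
      extend : (Σ ℕ λ k → Σ (Fin k → F.Carrier) λ a₀ → Σ (Fin k → Fin m → F.Carrier) λ a →
          Res._≈_ l (residue l P) (residue l (ΠE F (λ j → linearExpr F (a₀ j) (a j))))) →
        FactorizableMod F (squares F l) P
      extend (k , a₀ , a , P≈) = k , a₀ , a , residue≈⇒InIdeal l P (ΠE F (λ j → linearExpr F (a₀ j) (a j))) P≈

    module _ {m k : ℕ} (l : Fin m → F.Carrier) (a₀ : Fin k → F.Carrier) (a : Fin k → Fin m → F.Carrier) where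

      -- Chosen so that the diagonal entry ∑ₛ xₛ vₛᵢ² is the degree-one part of the i-th factor.
      rootVector : Fin m → Fin k → F.Carrier
      rootVector s i = proj₁ (squareRoot (a i s))

      private
        correction : Fin k → Fin k → F.Carrier
        correction i j = Sum.sum F (λ s → (l s F.* rootVector s i) F.* rootVector s j)

        choose : ∀ {i j : Fin k} → Dec (i ≡ j) → F.Carrier
        choose {i} {j} (yes _) = a₀ i
        choose {i} {j} (no _) = correction i j

        choose-sym : ∀ {i j} (d : Dec (i ≡ j)) (d′ : Dec (j ≡ i)) → choose d F.≈ choose d′
        choose-sym (yes ≡.refl) (yes _) = F.refl
        choose-sym (yes i≡j) (no j≢i) = contradiction (≡.sym i≡j) j≢i
        choose-sym (no i≢j) (yes j≡i) = contradiction (≡.sym j≡i) i≢j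
        choose-sym {i} {j} (no _) (no _) = Sum.sum-cong-≋ F λ s →
          N.solve 3 (λ l v w → (l N.:* v) N.:* w N.:= (l N.:* w) N.:* v) F.refl (l s) (rootVector s i) (rootVector s j)
          where module N = Algebra.Solver.Ring.NaturalCoefficients.Default F.commutativeSemiring

        choose-diagonal : ∀ {i} (d : Dec (i ≡ i)) → choose d F.≈ a₀ i
        choose-diagonal (yes _) = F.refl
        choose-diagonal (no i≢i) = contradiction ≡.refl i≢i

        choose-off : ∀ {i j} (d : Dec (i ≡ j)) → i ≢ j → choose d F.≈ correction i j
        choose-off (yes i≡j) i≢j = contradiction i≡j i≢j
        choose-off (no _) i≢j = F.refl

      -- Off the diagonal, the constant makes the entry ∑ₛ (xₛ + lₛ) vₛᵢ vₛⱼ of A + ∑ₛ xₛ vₛ vₛᵀ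
      -- square to zero modulo the ideal.
      baseMatrix : Fin k → Fin k → F.Carrier
      baseMatrix i j = choose (i Fin.≟ j)

      productMatrix : Fin (gadgetSize k m) → Fin (gadgetSize k m) → Entry F m
      productMatrix = gadgets (inj₁ F.0#) (inj₁ F.1#) m inj₂ (λ s i → inj₁ (rootVector s i)) (λ i j → inj₁ (baseMatrix i j))

      productDet : Expr F m
      productDet = det F (λ i j → entryExpr F (productMatrix i j))

      productMatrix-symmetric : Symmetric F productMatrix
      productMatrix-symmetric = gadgets-symmetric (inj₁ F.0#) (inj₁ F.1#) (_≈ᴱ_ F) ≈ᴱ-refl m inj₂
        (λ s i → inj₁ (rootVector s i)) (λ i j → choose-sym (i Fin.≟ j) (j Fin.≟ i))
        where
        ≈ᴱ-refl : ∀ (e : Entry F m) → _≈ᴱ_ F e e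
        ≈ᴱ-refl (inj₁ a) = F.refl
        ≈ᴱ-refl (inj₂ i) = lift ≡.refl

      -- The variable xᵢ occurs in the single row `variableRow m i`, and every entry there is a
      -- constant or a variable, hence of degree at most one.
      productDet-multilinear : Multilinear F productDet
      productDet-multilinear α i = det-degree-row (λ r s → entryExpr F (productMatrix r s)) (variableRow m i)
        (λ s → gadgets-all (inj₁ F.0#) (inj₁ F.1#) (DegreeBelow 2 i ∘ entryExpr F) (constant₂ F.0#) (constant₂ F.1#)
          (λ i′ j → constant₂ (baseMatrix i′ j)) m variable₂ (λ s j → constant₂ (rootVector s j)) _ s)
        (gadgets-otherRows (inj₁ F.0#) (inj₁ F.1#) (DegreeBelow 1 i ∘ entryExpr F) (con-degree i F.0#) (con-degree i F.1#)
          (λ i′ j → con-degree i (baseMatrix i′ j)) m i (λ s → var-degree i s) (λ s j → con-degree i (rootVector s j)))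
        α
        where
        constant₂ : ∀ b → DegreeBelow 2 i (con b)
        constant₂ b = relax-degree (con b) (s≤s z≤n) (con-degree i b)
        variable₂ : ∀ s → DegreeBelow 2 i (var s)
        variable₂ s = byCases (s Fin.≟ i)
          where
          byCases : Dec (s ≡ i) → DegreeBelow 2 i (var s)
          byCases (yes ≡.refl) = var-degree-self s
          byCases (no s≢i) = relax-degree (var s) (s≤s z≤n) (var-degree i s s≢i)

      private
        R = Residue m l
        module R = CommutativeRing R
        module RL = Linearity (residueLinearity m l)
        x = variableRes m l
        κ = K.⟪_⟫ l
      open Grassmann R
      open Product R

      private
        reduced : Mat R k
        reduced i j = κ (baseMatrix i j) R.+ Sum.sum R (λ s → (x s R.* κ (rootVector s i)) R.* κ (rootVector s j))

        reduced-diagonal : ∀ i → reduced i i R.≈ residue l (linearExpr F (a₀ i) (a i))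
        reduced-diagonal i = R.trans
          (R.+-cong (K.⟪⟫-cong l (choose-diagonal (i Fin.≟ i))) (Sum.sum-cong-≋ R λ s → R.trans
            (N.solve 2 (λ x v → (x N.:* v) N.:* v N.:= (v N.:* v) N.:* x) R.refl (x s) (κ (rootVector s i)))
            (R.*-congʳ (R.trans (R.sym (K.*-homo l (rootVector s i) (rootVector s i)))
              (K.⟪⟫-cong l (proj₂ (squareRoot (a i s))))))))
          (R.sym (residue-linearExpr l (a₀ i) (a i)))
          where module N = Algebra.Solver.Ring.NaturalCoefficients.Default R.commutativeSemiring

        -- The residue sends xₛ to lₛ, so the sum over s takes the value `correction i j`. The
        -- constant part has that value too, and in characteristic 2 the two cancel.
        reduced-off : ∀ i j → i ≢ j → reduced i j R.* reduced i j R.≈ R.0#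
        reduced-off i j i≢j = RL.residue≈0⇒square≈0 (F.trans (RL.ρ.+-homo _ _) (F.trans
          (F.+-cong (F.trans (value-constant l (baseMatrix i j)) (choose-off (i Fin.≟ j) i≢j))
            (F.trans (homo-sum {R = R} {S = F} RL.residue (λ s → (x s R.* κ (rootVector s i)) R.* κ (rootVector s j)))
              (Sum.sum-cong-≋ F λ s → F.trans (RL.ρ.*-homo _ _) (F.*-cong
                (F.trans (RL.ρ.*-homo _ _) (F.*-cong (value-variable m l s) (value-constant l (rootVector s i))))
                (value-constant l (rootVector s j))))))
          (Char2Ring.x+x≈0 F two≈0 (correction i j))))

      residue-productDet : residue l productDet R.≈ residue l (ΠE F (λ j → linearExpr F (a₀ j) (a j)))
      residue-productDet = begin
        residue l productDet
          ≈⟨ residue-det l productMatrix productMatrix-symmetric ⟩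
        top n (gaussian n (λ i j → residue l (entryExpr F (productMatrix i j))))
          ≈⟨ top-cong n (gaussian-cong n (gadgets-map (residue l ∘ entryExpr F) (K.0-homo l) (K.1-homo l)
               m inj₂ (λ s i → inj₁ (rootVector s i)) (λ i j → inj₁ (baseMatrix i j)))) ⟩
        top n (gaussian n (gadgets R.0# R.1# m x (λ s i → κ (rootVector s i)) (λ i j → κ (baseMatrix i j))))
          ≈⟨ top-gaussian-gadgets RL.char2 m x (λ s i → κ (rootVector s i)) (λ i j → κ (baseMatrix i j)) ⟩
        top k (gaussian k reduced)
          ≈⟨ top-gaussian-diagonal R k reduced reduced-off ⟩
        product (λ i → reduced i i)
          ≈⟨ product-cong reduced-diagonal ⟩
        product (λ i → residue l (linearExpr F (a₀ i) (a i)))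
          ≈⟨ eval-ΠE R (constantRes m l) x (λ j → linearExpr F (a₀ j) (a j)) ⟨
        residue l (ΠE F (λ j → linearExpr F (a₀ j) (a j))) ∎
        where
        open Relation.Binary.Reasoning.Setoid R.setoid
        open Gadgets R
        n = gadgetSize k m

    multilinear-residue-injective : ∀ {m} (l : Fin m → F.Carrier) P Q → Multilinear F P → Multilinear F Q →
      Res._≈_ l (residue l P) (residue l Q) → _≋_ F P Q
    multilinear-residue-injective {m} l P Q multP multQ e α = x∙y⁻¹≈ε⇒x≈y _ _
      (F.trans (F.sym (coefficient-polynomial (P ⊕ neg Q) α))
        (project-injective m l (polynomial (P ⊕ neg Q))
          (λ β i le → F.trans (coefficient-polynomial (P ⊕ neg Q) β)
            (⊕-degree P (neg Q) (λ β′ → multP β′ i) (neg-degree Q (λ β′ → multQ β′ i)) β le))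
          (Res.trans l (project-polynomial l (P ⊕ neg Q))
            (Res.trans l (Res.+-congʳ l e) (Res.-‿inverseʳ l (residue l Q))))
          α))
      where open Algebra.Properties.Group (AbelianGroup.group F.+-abelianGroup) using (x∙y⁻¹≈ε⇒x≈y)

    factorizable⇒representable : ∀ {m} (P : Expr F m) → Multilinear F P →
      ∀ l → FactorizableMod F (squares F l) P → Representable F P
    factorizable⇒representable {m} P multP l (k , a₀ , a , ideal) =
      gadgetSize k m , productMatrix l a₀ a , productMatrix-symmetric l a₀ a ,
        multilinear-residue-injective l (productDet l a₀ a) P (productDet-multilinear l a₀ a) multP
          (Res.trans l (residue-productDet l a₀ a)
            (Res.sym l (InIdeal⇒residue≈ l P (ΠE F (λ j → linearExpr F (a₀ j) (a j))) ideal)))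

theorem4p10 : ∀ {c ℓ : Level} (F : CommutativeRing c ℓ) → IsFiniteField F → Char2 F →
    (m : ℕ) (P : Expr F m) → Multilinear F P →
    (Representable F P ⇔ (∀ (l : Fin m → CommutativeRing.Carrier F) → FactorizableMod F (squares F l) P))
    × (Representable F P ⇔ ∃ (λ (l : Fin m → CommutativeRing.Carrier F) → FactorizableMod F (squares F l) P))
theorem4p10 F finite two≈0 m P multP =
    mk⇔ to (λ factorizable → from (origin , factorizable origin))
  , mk⇔ (λ representable → origin , to representable origin) from
  where
  open Representability F finite two≈0
  -- Passing from all `l` to some `l` takes one point of the space; zero serves.
  origin : Fin m → CommutativeRing.Carrier F
  origin _ = CommutativeRing.0# F
  to : Representable F P → ∀ l → FactorizableMod F (squares F l) P
  to = representable⇒factorizable P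
  from : ∃ (λ l → FactorizableMod F (squares F l) P) → Representable F P
  from (l , factorizable) = factorizable⇒representable P multP l factorizable
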